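{- For integers $k\ge 1$ and $l\ge 2$, as $n\to\infty$, $$ex(n,P_l,C_{2k+1})=(1+o(1))\left(\frac n2\right)^l.$$
   Context: $C_k$ denotes the cycle with $k$ vertices and $P_l$ the path with $l$ vertices. $ex(n,H,F)$ is the maximum number of subgraphs isomorphic to $H$ in an $n$-vertex graph containing no subgraph isomorphic to $F$. -}

module Defs where

open import Algebra.Definitions.RawSemiring using () renaming (_^_ to pow)
open import Data.Bool.Base using (true; false)
open import Data.Fin.Base using (Fin; toℕ)
import Data.Fin.Properties as Fin
open import Data.Fin.Subset using (Subset; _∈_)
open import Data.Fin.Subset.Properties using (_∈?_)
open import Data.Integer.Base using (+_)
open import Data.List.Base
  using (List; []; _∷_; length; map; filter; cartesianProduct; cartesianProductWith; allFin)
open import Data.List.Extrema.Nat using (max; xs≤max; max≤v⁺; argmax; f[xs]≤f[argmax]; argmax-all)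
import Data.List.Membership.Propositional as List
open import Data.List.Membership.Propositional.Properties
  using (∈-map⁺; ∈-map⁻; ∈-filter⁺; ∈-filter⁻; ∈-cartesianProduct⁺; ∈-cartesianProductWith⁺; ∈-allFin)
open import Data.List.Properties using (filter-≐)
open import Data.List.Relation.Unary.All as All using ([]; _∷_)
open import Data.List.Relation.Unary.AllPairs using ([]; _∷_)
open import Data.List.Relation.Unary.Any as Any using (here; there)
open import Data.List.Relation.Unary.Unique.Propositional using (Unique)
open import Data.List.Relation.Unary.Unique.Propositional.Properties
  using (cartesianProduct⁺; cartesianProductWith⁺)
open import Data.Nat.Base as ℕ using (ℕ; zero; suc; NonZero)
import Data.Nat.Properties as ℕ
open import Data.Nat.DivMod using (_%_)
open import Data.Product.Base using (∃; ∃-syntax; _×_; _,_; proj₁; proj₂)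
open import Data.Rational.Base as ℚ using (ℚ; 0ℚ; 1ℚ; ∣_∣)
open import Data.Sum.Base using (_⊎_; inj₁; inj₂)
open import Data.Vec.Base using (Vec; []; _∷_; lookup; tabulate)
open import Data.Vec.Properties using (∷-injective; lookup∘tabulate; lookup⇒[]=; []=⇒lookup)
open import Function.Base using (_∘_)
open import Function.Bundles using (_⇔_; mk⇔; Equivalence)
open import Function.Definitions using (Injective)
open import Level using (0ℓ)
open import Relation.Binary.Core using (Rel)
open import Relation.Binary.Definitions using (Decidable)
open import Relation.Binary.PropositionalEquality
  using (_≡_; _≢_; refl; sym; trans; cong; subst; subst₂; _≗_)
open import Relation.Nullary.Decidable
  using (Dec; yes; no; does; map′; ¬?; _×-dec_; _⊎-dec_; _→-dec_; dec-true)
open import Relation.Nullary.Negation using (¬_)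

open Equivalence using (to; from)

-- Adjacency matrices: row u is the set of out-neighbours of u.
-- First-order data, so that _≡_ is the intended equality.
Matrix : ℕ → Set
Matrix n = Vec (Subset n) n

_⟨_⇢_⟩ : ∀ {n} → Matrix n → Fin n → Fin n → Set
A ⟨ u ⇢ v ⟩ = v ∈ lookup A u

matrix : ∀ {n} {R : Rel (Fin n) 0ℓ} → Decidable R → Matrix n
matrix R? = tabulate λ u → tabulate λ v → does (R? u v)

matrix⁺ : ∀ {n} {R : Rel (Fin n) 0ℓ} (R? : Decidable R) {u v} →
          R u v → matrix R? ⟨ u ⇢ v ⟩
matrix⁺ R? {u} {v} r
  rewrite lookup∘tabulate (λ u → tabulate (λ v → does (R? u v))) u
  = lookup⇒[]= v _ (trans (lookup∘tabulate _ v) (dec-true (R? u v) r))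

matrix⁻ : ∀ {n} {R : Rel (Fin n) 0ℓ} (R? : Decidable R) {u v} →
          matrix R? ⟨ u ⇢ v ⟩ → R u v
matrix⁻ R? {u} {v} e
  rewrite lookup∘tabulate (λ u → tabulate (λ v → does (R? u v))) u
  with R? u v | trans (sym (lookup∘tabulate (λ v → does (R? u v)) v)) ([]=⇒lookup e)
... | yes r | _ = r

record Graph (n : ℕ) : Set where
  field
    adjacency   : Matrix n
    symmetric   : ∀ {u v} → adjacency ⟨ u ⇢ v ⟩ → adjacency ⟨ v ⇢ u ⟩
    irreflexive : ∀ {u} → ¬ adjacency ⟨ u ⇢ u ⟩

  Edge : Fin n → Fin n → Set
  Edge u v = adjacency ⟨ u ⇢ v ⟩

open Graph public using (Edge)

-- u and v are adjacent iff they are distinct and related by R in one of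
-- the two directions.
module _ {n} {R : Rel (Fin n) 0ℓ} (R? : Decidable R) where

  Linked : Fin n → Fin n → Set
  Linked u v = u ≢ v × (R u v ⊎ R v u)

  linked? : Decidable Linked
  linked? u v = ¬? (u Fin.≟ v) ×-dec (R? u v ⊎-dec R? v u)

  fromRel : Graph n
  fromRel = record
    { adjacency   = matrix linked?
    ; symmetric   = λ e → matrix⁺ linked? (flip (matrix⁻ linked? e))
    ; irreflexive = λ e → proj₁ (matrix⁻ linked? e) refl
    }
    where
    flip : ∀ {u v} → Linked u v → Linked v u
    flip (u≢v , inj₁ r) = u≢v ∘ sym , inj₂ r
    flip (u≢v , inj₂ r) = u≢v ∘ sym , inj₁ r

  fromRel-edge : ∀ {u v} → Edge fromRel u v ⇔ Linked u v
  fromRel-edge = mk⇔ (matrix⁻ linked?) (matrix⁺ linked?)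

P : ∀ l → Graph l
P l = fromRel {R = λ i j → suc (toℕ i) ≡ toℕ j} (λ _ _ → _ ℕ.≟ _)

-- A cycle only for k ≥ 3; C 2 is a single edge and C 1 a single vertex.
C : ∀ k .{{_ : NonZero k}} → Graph k
C k = fromRel {R = λ i j → suc (toℕ i) % k ≡ toℕ j} (λ _ _ → _ ℕ.≟ _)

-- A vertex set together with an edge relation, with no condition relating
-- them; those are imposed by IsSubgraph.
Subdata : ℕ → Set
Subdata n = Subset n × Matrix n

record IsSubgraph {n} (G : Graph n) (S : Subdata n) : Set where
  private
    W = proj₁ S
    E = proj₂ S
  field
    symmetric : ∀ u v → E ⟨ u ⇢ v ⟩ → E ⟨ v ⇢ u ⟩
    endpoint  : ∀ u v → E ⟨ u ⇢ v ⟩ → u ∈ W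
    edge      : ∀ u v → E ⟨ u ⇢ v ⟩ → Edge G u v

record IsIsomorphism {h n} (H : Graph h) (S : Subdata n) (f : Fin h → Fin n) : Set where
  private
    W = proj₁ S
    E = proj₂ S
  field
    injective : Injective _≡_ _≡_ f
    into      : ∀ i → f i ∈ W
    onto      : ∀ w → w ∈ W → ∃[ i ] f i ≡ w
    edge      : ∀ i j → Edge H i j ⇔ E ⟨ f i ⇢ f j ⟩

_≅_ : ∀ {h n} → Graph h → Subdata n → Set
H ≅ S = ∃ (IsIsomorphism H S)

IsCopy : ∀ {h n} → Graph h → Graph n → Subdata n → Set
IsCopy H G S = IsSubgraph G S × H ≅ S

_Free : ∀ {f n} → Graph f → Graph n → Set
(F Free) G = ¬ ∃ (IsCopy F G)

vectors : ∀ {A : Set} → List A → ∀ m → List (Vec A m)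
vectors xs zero    = [] ∷ []
vectors xs (suc m) = cartesianProductWith _∷_ xs (vectors xs m)

vectors-complete : ∀ {A : Set} {xs : List A} → (∀ x → x List.∈ xs) →
                   ∀ {m} (v : Vec A m) → v List.∈ vectors xs m
vectors-complete all []      = here refl
vectors-complete all (x ∷ v) = ∈-cartesianProductWith⁺ _∷_ (all x) (vectors-complete all v)

vectors-unique : ∀ {A : Set} {xs : List A} → Unique xs → ∀ m → Unique (vectors xs m)
vectors-unique xs! zero    = [] ∷ []
vectors-unique xs! (suc m) =
  cartesianProductWith⁺ _∷_ ∷-injective xs! (vectors-unique xs! m)

subsets : ∀ n → List (Subset n)
subsets = vectors (true ∷ false ∷ [])

subsets-complete : ∀ {n} (W : Subset n) → W List.∈ subsets n
subsets-complete = vectors-complete λ { true → here refl ; false → there (here refl) }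

subsets-unique : ∀ n → Unique (subsets n)
subsets-unique = vectors-unique (((λ ()) ∷ []) ∷ [] ∷ [])

matrices : ∀ n → List (Matrix n)
matrices n = vectors (subsets n) n

matrices-complete : ∀ {n} (A : Matrix n) → A List.∈ matrices n
matrices-complete = vectors-complete subsets-complete

subdata : ∀ n → List (Subdata n)
subdata n = cartesianProduct (subsets n) (matrices n)

subdata-complete : ∀ {n} (S : Subdata n) → S List.∈ subdata n
subdata-complete (W , A) = ∈-cartesianProduct⁺ (subsets-complete W) (matrices-complete A)

subdata-unique : ∀ n → Unique (subdata n)
subdata-unique n =
  cartesianProduct⁺ (subsets-unique n) (vectors-unique (subsets-unique n) n)

-- Every graph occurs up to equality of its edge relation, possibly many times.
graphs : ∀ n → List (Graph n)
graphs n = map (λ A → fromRel (λ u v → v ∈? lookup A u)) (matrices n)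

_≈_ : ∀ {n} → Graph n → Graph n → Set
G ≈ G′ = ∀ u v → Edge G u v ⇔ Edge G′ u v

graphs-complete : ∀ {n} (G : Graph n) → ∃[ G′ ] G′ List.∈ graphs n × G ≈ G′
graphs-complete G = _ , ∈-map⁺ _ (matrices-complete adjacency) , λ u v → mk⇔
  (λ e → from (fromRel-edge R?) ((λ { refl → irreflexive e }) , inj₁ e))
  (λ e → undirect (proj₂ (to (fromRel-edge R?) e)))
  where
  open Graph G hiding (Edge)
  R? = λ u v → v ∈? lookup adjacency u
  undirect : ∀ {u v} → Edge G u v ⊎ Edge G v u → Edge G u v
  undirect (inj₁ e) = e
  undirect (inj₂ e) = symmetric e

∃? : ∀ {A : Set} {Q : A → Set} {xs : List A} → (∀ x → x List.∈ xs) →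
     (∀ x → Dec (Q x)) → Dec (∃ Q)
∃? all Q? = map′ Any.satisfied (λ (x , q) → List.lose (all x) q) (Any.any? Q? _)

∃-function? : ∀ {h n} {Q : (Fin h → Fin n) → Set} →
              (∀ {f g} → f ≗ g → Q f → Q g) → (∀ f → Dec (Q f)) → Dec (∃ Q)
∃-function? resp Q? = map′
  (λ (v , q) → lookup v , q)
  (λ (f , q) → tabulate f , resp (sym ∘ lookup∘tabulate f) q)
  (∃? (vectors-complete (∈-allFin {_})) (Q? ∘ lookup))

_⇔-dec_ : ∀ {A B : Set} → Dec A → Dec B → Dec (A ⇔ B)
A? ⇔-dec B? = map′ (λ (f , g) → mk⇔ f g) (λ e → to e , from e)
  ((A? →-dec B?) ×-dec (B? →-dec A?))

isSubgraph? : ∀ {n} (G : Graph n) S → Dec (IsSubgraph G S)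
isSubgraph? G (W , E) = map′
  (λ (s , p , e) → record { symmetric = s ; endpoint = p ; edge = e })
  (λ r → let open IsSubgraph r in symmetric , endpoint , edge)
  (  Fin.all? (λ u → Fin.all? λ v → (v ∈? lookup E u) →-dec (u ∈? lookup E v))
  ×-dec Fin.all? (λ u → Fin.all? λ v → (v ∈? lookup E u) →-dec (u ∈? W))
  ×-dec Fin.all? (λ u → Fin.all? λ v →
          (v ∈? lookup E u) →-dec (v ∈? lookup (Graph.adjacency G) u)))

isIsomorphism? : ∀ {h n} (H : Graph h) (S : Subdata n) f → Dec (IsIsomorphism H S f)
isIsomorphism? H (W , E) f = map′
  (λ (a , b , c , d) → record
    { injective = λ {i} {j} → a i j ; into = b ; onto = c ; edge = d })
  (λ r → let open IsIsomorphism r in (λ i j → injective) , into , onto , edge)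
  (  Fin.all? (λ i → Fin.all? λ j → (f i Fin.≟ f j) →-dec (i Fin.≟ j))
  ×-dec Fin.all? (λ i → f i ∈? W)
  ×-dec Fin.all? (λ w → (w ∈? W) →-dec Fin.any? (λ i → f i Fin.≟ w))
  ×-dec Fin.all? (λ i → Fin.all? λ j →
          (j ∈? lookup (Graph.adjacency H) i) ⇔-dec (f j ∈? lookup E (f i))))

isIsomorphism-resp : ∀ {h n} {H : Graph h} {S : Subdata n} {f g} → f ≗ g →
                     IsIsomorphism H S f → IsIsomorphism H S g
isIsomorphism-resp {S = W , E} f≗g r = record
  { injective = λ {i} {j} gi≡gj →
      injective (trans (f≗g i) (trans gi≡gj (sym (f≗g j))))
  ; into = λ i → subst (_∈ W) (f≗g i) (into i)
  ; onto = λ w w∈W → let i , fi≡w = onto w w∈W in i , trans (sym (f≗g i)) fi≡w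
  ; edge = λ i j → mk⇔
      (subst₂ (E ⟨_⇢_⟩) (f≗g i) (f≗g j) ∘ to (edge i j))
      (from (edge i j) ∘ subst₂ (E ⟨_⇢_⟩) (sym (f≗g i)) (sym (f≗g j)))
  }
  where open IsIsomorphism r

isCopy? : ∀ {h n} (H : Graph h) (G : Graph n) S → Dec (IsCopy H G S)
isCopy? H G S =
  isSubgraph? G S ×-dec ∃-function? isIsomorphism-resp (isIsomorphism? H S)

free? : ∀ {f n} (F : Graph f) (G : Graph n) → Dec ((F Free) G)
free? F G = ¬? (∃? subdata-complete (isCopy? F G))

copies : ∀ {h n} → Graph h → Graph n → ℕ
copies H G = length (filter (isCopy? H G) (subdata _))

-- The default value 0 is only relevant when no n-vertex graph is F-free.
ex : ∀ {h f} → ℕ → Graph h → Graph f → ℕ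
ex n H F = max 0 (map (copies H) (filter (free? F) (graphs n)))

isCopy-resp : ∀ {h n} {H : Graph h} {G G′ : Graph n} {S} → G ≈ G′ →
              IsCopy H G S → IsCopy H G′ S
isCopy-resp G≈G′ (r , iso) = record
  { symmetric = symmetric
  ; endpoint  = endpoint
  ; edge      = λ u v → to (G≈G′ u v) ∘ edge u v
  } , iso
  where open IsSubgraph r

≈-sym : ∀ {n} {G G′ : Graph n} → G ≈ G′ → G′ ≈ G
≈-sym G≈G′ u v = mk⇔ (from (G≈G′ u v)) (to (G≈G′ u v))

copies-cong : ∀ {h n} (H : Graph h) {G G′ : Graph n} → G ≈ G′ → copies H G ≡ copies H G′
copies-cong H {G} {G′} G≈G′ = cong length
  (filter-≐ (isCopy? H G) (isCopy? H G′)
    ( isCopy-resp {G = G} {G′} G≈G′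
    , isCopy-resp {G = G′} {G} (≈-sym {G = G} {G′} G≈G′)) (subdata _))

module _ {A : Set} {Q : A → Set} (Q? : ∀ x → Dec (Q x)) (f : A → ℕ) (xs : List A) where

  private
    ys = filter Q? xs
    M  = max 0 (map f ys)

  max-upper : ∀ {x} → x List.∈ xs → Q x → f x ℕ.≤ M
  max-upper x∈xs q = All.lookup (xs≤max 0 (map f ys)) (∈-map⁺ f (∈-filter⁺ Q? x∈xs q))

  max-attained : ∀ {x} → Q x → f x ℕ.≤ M → ∃[ y ] Q y × f y ≡ M
  max-attained {x} q fx≤M = y , proj₁ y-ok , ℕ.≤-antisym (proj₂ y-ok)
    (max≤v⁺ ℕ.z≤n (All.tabulate bound))
    where
    y = argmax f x ys
    y-ok : Q y × f y ℕ.≤ M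
    y-ok = argmax-all f {P = λ z → Q z × f z ℕ.≤ M} (q , fx≤M)
      (All.tabulate λ z∈ys → let z∈xs , qz = ∈-filter⁻ Q? {xs = xs} z∈ys
                             in qz , max-upper z∈xs qz)
    bound : ∀ {m} → m List.∈ map f ys → m ℕ.≤ f y
    bound m∈ with z , z∈ys , refl ← ∈-map⁻ f m∈ =
      All.lookup (f[xs]≤f[argmax] {f = f} x ys) z∈ys

ex-upper : ∀ {h f n} (H : Graph h) (F : Graph f) {G : Graph n} →
           (F Free) G → copies H G ℕ.≤ ex n H F
ex-upper {n = n} H F {G} free = bound (graphs-complete G)
  where
  bound : ∃[ G′ ] G′ List.∈ graphs n × G ≈ G′ → copies H G ℕ.≤ ex n H F
  bound (G′ , G′∈ , G≈G′) = subst (ℕ._≤ ex n H F) (sym (copies-cong H {G} {G′} G≈G′))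
    (max-upper (free? F) (copies H) (graphs n) G′∈
      λ (S , c) → free (S , isCopy-resp {G = G′} {G} (≈-sym {G = G} {G′} G≈G′) c))

ex-attained : ∀ {h f n} (H : Graph h) (F : Graph f) {G : Graph n} → (F Free) G →
              ∃[ G* ] (F Free) G* × copies H G* ≡ ex n H F
ex-attained {n = n} H F {G} free =
  max-attained {Q = F Free} (free? F) (copies H) (graphs n) {x = G} free
    (ex-upper H F {G} free)

infixr 8 _^_
_^_ : ℚ → ℕ → ℚ
_^_ = pow ℚ.+-*-rawSemiring

fromℕ : ℕ → ℚ
fromℕ m = + m ℚ./ 1

Eventually : (ℕ → Set) → Set
Eventually Q = ∃[ N ] ∀ n → N ℕ.≤ n → Q n

o[1] : (ℕ → ℚ) → Set
o[1] δ = ∀ ε → 0ℚ ℚ.< ε → Eventually λ n → ∣ δ n ∣ ℚ.< ε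

_≡[1+o[1]]_ : (ℕ → ℚ) → (ℕ → ℚ) → Set
a ≡[1+o[1]] b = ∃[ δ ] o[1] δ × Eventually λ n → a n ≡ (1ℚ ℚ.+ δ n) ℚ.* b n

-- In a graph without C (2k+1) the neighbourhood of a vertex has no path on 2k
-- vertices, hence spans O(n) edges, so the graph has O(n²) triangles.  Up to
-- these triangles, a neighbourhood is independent: every edge meets N(v) at
-- most once, so the degrees in N(v) sum to at most the number e of edges.  Let
-- w m be the number of walks with m edges, so that w 1 = 2e.  Peeling two
-- edges off a walk gives
--
--   2 w (m + 2) ≤ w 1 · w m + O(n ^ (m + 2)),
--
-- while (w 1)² ≤ n · w 2 by Cauchy–Schwarz.  Hence w 1 ≤ n² / 2 + O(n), and
-- inductively w m ≤ 2 (n / 2) ^ (m + 1) + O(n ^ m).  A copy of P l yields two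
-- walks with l - 1 edges, which is the upper bound.  The balanced complete
-- bipartite graph attains it: its paths are built vertex by vertex, with
-- n / 2 - O(1) choices at each step but the first.

{-# OPTIONS --safe #-}
module Submission where

open import Defs
open import Data.Bool.Base using (Bool; true; false; not; if_then_else_)
import Data.Bool.Properties as Bool
open import Data.Fin.Base using (Fin; zero; suc; toℕ; fromℕ<)
import Data.Fin.Base as Fin
import Data.Fin.Properties as Fin
open import Data.Fin.Induction using (<-weakInduction)
open import Data.Fin.Subset using (Subset; _∈_)
open import Data.Fin.Subset.Properties using (_∈?_; ⊆-antisym)
open import Data.Integer using (+_)
import Data.Integer as ℤ
import Data.Integer.Properties as ℤ
open import Data.List.Base using (List; []; _∷_; length; filter; allFin; _++_; cartesianProductWith)
import Data.List.Base as List
import Data.List.Properties as List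
import Data.List.Membership.Propositional as List
import Data.List.Membership.Propositional.Properties as List
import Data.List.Relation.Unary.All as ListAll
import Data.List.Relation.Unary.AllPairs as ListAllPairs
open import Data.List.Relation.Unary.Any using (here; there)
import Data.List.Relation.Unary.Unique.Propositional as List
import Data.List.Relation.Unary.Unique.Propositional.Properties as List
open import Data.Nat using (ℕ; zero; suc; _+_; _*_; _∸_; _≤_; _<_; z≤n; s≤s; NonZero)
import Data.Nat as ℕ
open import Data.Nat.DivMod using (_%_; m<n⇒m%n≡m; n%n≡0)
import Data.Nat.Properties as ℕ
open import Data.Nat.Tactic.RingSolver using (solve-∀)
open import Data.Product.Base using (∃; ∃-syntax; _×_; _,_; proj₁; proj₂)
open import Data.Rational using (0ℚ; 1ℚ; _/_)
import Data.Rational as ℚ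
import Data.Rational.Properties as ℚ
import Data.Rational.Unnormalised as ℚᵘ
import Data.Rational.Unnormalised.Properties as ℚᵘ
open import Data.Sum.Base using (_⊎_; inj₁; inj₂)
open import Data.Unit.Base using (⊤; tt)
open import Data.Vec.Base using (Vec; []; _∷_; lookup; tabulate)
open import Data.Vec.Properties
  using (lookup∘tabulate; tabulate∘lookup; tabulate-cong; lookup⇒[]=; []=⇒lookup)
open import Data.Vec.Relation.Unary.All as All using (All; []; _∷_)
import Data.Vec.Relation.Unary.All.Properties as All
open import Data.Vec.Relation.Unary.AllPairs using ([]; _∷_)
import Data.Vec.Relation.Unary.AllPairs as AllPairs
import Data.Vec.Relation.Unary.Linked as Linked
open import Data.Vec.Relation.Unary.Linked using ([-]; _∷_)
open import Data.Vec.Relation.Unary.Unique.Propositional using (Unique)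
open import Data.Vec.Relation.Unary.Unique.Propositional.Properties using (lookup-injective)
open import Function.Base using (_∘_; id)
open import Function.Bundles using (_⇔_; mk⇔; Equivalence)
open import Function.Definitions using (Injective)
open import Level using (0ℓ)
open import Relation.Binary.Core using (Rel)
open import Relation.Binary.Definitions using (Decidable; Symmetric)
open import Relation.Binary.PropositionalEquality
open import Relation.Nullary.Decidable
open import Relation.Nullary.Negation using (¬_; contradiction)

import Algebra.Properties.Semiring.Sum ℕ.+-*-semiring as Sum
open import Algebra.Definitions.RawMonoid ℕ.+-0-rawMonoid using (sum)

open Equivalence using (to; from)

-- The error terms decide which tools suffice. The product `w 1 · w m` may reach the order n^(m +
-- 3), while linearly many triangles at each vertex cost only n^(m + 2). So only the linear order of
-- the edge count in a neighbourhood matters, not its constant, and a crude pruning argument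
-- replaces the sharp extremal number of a path.
--
-- A copy is a vertex set with an edge matrix and cannot be counted vertex by vertex. It is
-- exchanged for its traversals, vectors of vertices, exactly two per copy. Walks and paths are then
-- counted by recursion on the vector.
--
-- All estimates are between natural numbers, with the powers of 2 multiplied out, and amount to
-- |2^l ex - n^l| ≤ K n^(l - 1) with `K` depending on k and l alone. Rationals enter only at the
-- end, where division by n^l gives a relative error of at most K / n.

-- Finite sums, Cauchy-Schwarz and indicators

-- Opaque, so that unification can read the summand off a sum.
opaque
  ∑ : ∀ n → (Fin n → ℕ) → ℕ
  ∑ _ = sum

syntax ∑ n (λ i → x) = ∑[ i < n ] x

opaque
  unfolding ∑

  ∑-zero : (f : Fin 0 → ℕ) → ∑[ i < 0 ] f i ≡ 0
  ∑-zero f = refl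

  ∑-suc : ∀ {n} (f : Fin (suc n) → ℕ) → ∑[ i < suc n ] f i ≡ f zero + ∑[ i < n ] f (suc i)
  ∑-suc f = refl

  ∑-mono : ∀ {n} {f g : Fin n → ℕ} → (∀ i → f i ≤ g i) → ∑[ i < n ] f i ≤ ∑[ i < n ] g i
  ∑-mono {zero}  f≤g = z≤n
  ∑-mono {suc n} f≤g = ℕ.+-mono-≤ (f≤g zero) (∑-mono (f≤g ∘ suc))

  ∑-≤-const : ∀ {n c} {f : Fin n → ℕ} → (∀ i → f i ≤ c) → ∑[ i < n ] f i ≤ n * c
  ∑-≤-const {zero}  f≤c = z≤n
  ∑-≤-const {suc n} f≤c = ℕ.+-mono-≤ (f≤c zero) (∑-≤-const (f≤c ∘ suc))

  ∑-const : ∀ n c → ∑[ i < n ] c ≡ n * c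
  ∑-const zero    c = refl
  ∑-const (suc n) c = cong (λ t → c + t) (∑-const n c)

  ∑-cong : ∀ {n} {f g : Fin n → ℕ} → (∀ i → f i ≡ g i) → ∑[ i < n ] f i ≡ ∑[ i < n ] g i
  ∑-cong = Sum.sum-cong-≗

  ∑-distrib-+ : ∀ {n} (f g : Fin n → ℕ) →
                ∑[ i < n ] (f i + g i) ≡ ∑[ i < n ] f i + ∑[ i < n ] g i
  ∑-distrib-+ = Sum.∑-distrib-+

  ∑-comm : ∀ {m n} (f : Fin m → Fin n → ℕ) →
           ∑[ i < m ] ∑[ j < n ] f i j ≡ ∑[ j < n ] ∑[ i < m ] f i j
  ∑-comm = Sum.∑-comm

  *-distribˡ-∑ : ∀ {n} c (f : Fin n → ℕ) → c * ∑[ i < n ] f i ≡ ∑[ i < n ] (c * f i)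
  *-distribˡ-∑ = Sum.*-distribˡ-sum

  *-distribʳ-∑ : ∀ {n} c (f : Fin n → ℕ) → (∑[ i < n ] f i) * c ≡ ∑[ i < n ] (f i * c)
  *-distribʳ-∑ = Sum.*-distribʳ-sum

module _ {m n : ℕ} where

  ∑∑-mono : {f g : Fin m → Fin n → ℕ} → (∀ i j → f i j ≤ g i j) →
            ∑[ i < m ] ∑[ j < n ] f i j ≤ ∑[ i < m ] ∑[ j < n ] g i j
  ∑∑-mono f≤g = ∑-mono λ i → ∑-mono (f≤g i)

  ∑∑-cong : {f g : Fin m → Fin n → ℕ} → (∀ i j → f i j ≡ g i j) →
            ∑[ i < m ] ∑[ j < n ] f i j ≡ ∑[ i < m ] ∑[ j < n ] g i j
  ∑∑-cong f≡g = ∑-cong λ i → ∑-cong (f≡g i)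

  ∑∑-distrib-+ : (f g : Fin m → Fin n → ℕ) →
                 ∑[ i < m ] ∑[ j < n ] (f i j + g i j) ≡
                 ∑[ i < m ] ∑[ j < n ] f i j + ∑[ i < m ] ∑[ j < n ] g i j
  ∑∑-distrib-+ f g = trans (∑-cong λ i → ∑-distrib-+ (f i) (g i)) (∑-distrib-+ _ _)

am-gm : ∀ x y → 2 * (x * y) ≤ x * x + y * y
am-gm x y with ℕ.≤-total x y
... | inj₁ x≤y with t , refl ← ℕ.m≤n⇒∃[o]m+o≡n x≤y = subst (2 * (x * (x + t)) ≤_) (eq x t) (ℕ.m≤m+n (2 * (x * (x + t))) (t * t))
  where
  eq : ∀ x t → 2 * (x * (x + t)) + t * t ≡ x * x + (x + t) * (x + t)
  eq = solve-∀
... | inj₂ y≤x with t , refl ← ℕ.m≤n⇒∃[o]m+o≡n y≤x = subst (2 * ((y + t) * y) ≤_) (eq y t) (ℕ.m≤m+n (2 * ((y + t) * y)) (t * t))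
  where
  eq : ∀ y t → 2 * ((y + t) * y) + t * t ≡ (y + t) * (y + t) + y * y
  eq = solve-∀

-- `am-gm` summed over all ordered pairs of indices; the factor 2 avoids subtraction and is
-- cancelled at the end.
cauchy-schwarz : ∀ {n} (f : Fin n → ℕ) →
                 (∑[ i < n ] f i) * (∑[ i < n ] f i) ≤ n * ∑[ i < n ] (f i * f i)
cauchy-schwarz {n} f = ℕ.*-cancelˡ-≤ 2 (begin
  2 * (s * s)                                         ≡⟨ cong (2 *_) (*-distribʳ-∑ s f) ⟩
  2 * ∑[ i < n ] (f i * s)                            ≡⟨ *-distribˡ-∑ 2 _ ⟩
  ∑[ i < n ] (2 * (f i * s))
    ≡⟨ ∑-cong (λ i → trans (cong (2 *_) (*-distribˡ-∑ (f i) f)) (*-distribˡ-∑ 2 _)) ⟩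
  ∑[ i < n ] ∑[ j < n ] (2 * (f i * f j))             ≤⟨ ∑∑-mono (λ i j → am-gm (f i) (f j)) ⟩
  ∑[ i < n ] ∑[ j < n ] (f i * f i + f j * f j)
    ≡⟨ ∑∑-distrib-+ (λ i j → f i * f i) (λ i j → f j * f j) ⟩
  ∑[ i < n ] ∑[ j < n ] (f i * f i) + ∑[ i < n ] q
    ≡⟨ cong₂ ℕ._+_ (trans (∑-cong λ i → ∑-const n _) (sym (*-distribˡ-∑ n _))) (∑-const n q) ⟩
  n * q + n * q                                       ≡⟨ eq (n * q) ⟩
  2 * (n * q)                                         ∎)
  where
  open ℕ.≤-Reasoning
  s = ∑[ i < n ] f i
  q = ∑[ i < n ] (f i * f i)
  eq : ∀ x → x + x ≡ 2 * x
  eq = solve-∀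

𝟙 : {A : Set} → Dec A → ℕ
𝟙 A? = if does A? then 1 else 0

𝟙≤1 : {A : Set} (A? : Dec A) → 𝟙 A? ≤ 1
𝟙≤1 (yes _) = ℕ.≤-refl
𝟙≤1 (no _)  = z≤n

𝟙-cong : {A B : Set} → A ⇔ B → (A? : Dec A) (B? : Dec B) → 𝟙 A? ≡ 𝟙 B?
𝟙-cong A⇔B (yes a) (yes b) = refl
𝟙-cong A⇔B (yes a) (no ¬b) = contradiction (to A⇔B a) ¬b
𝟙-cong A⇔B (no ¬a) (yes b) = contradiction (from A⇔B b) ¬a
𝟙-cong A⇔B (no ¬a) (no ¬b) = refl

𝟙-no : {A : Set} → ¬ A → (A? : Dec A) → 𝟙 A? ≡ 0
𝟙-no ¬a (yes a) = contradiction a ¬a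
𝟙-no ¬a (no _)  = refl

𝟙-× : {A B : Set} (A? : Dec A) (B? : Dec B) → 𝟙 (A? ×-dec B?) ≡ 𝟙 A? * 𝟙 B?
𝟙-× (yes a) (yes b) = refl
𝟙-× (yes a) (no ¬b) = refl
𝟙-× (no ¬a) B?      = refl

-- Walks in a graph with few triangles at each vertex

-- The coefficient of the error term in walks≤ below, as walks-step propagates it.
errorConstant : ℕ → ℕ → ℕ
errorConstant c zero          = 0
errorConstant c (suc zero)    = 2 * c
errorConstant c (suc (suc m)) = errorConstant c m + 2 * c + 2 * c * errorConstant c m + 2 ℕ.^ suc m * c

module WeightedWalks {n : ℕ} (a : Fin n → Fin n → ℕ)
                     (a≤1 : ∀ u v → a u v ≤ 1) (a-sym : ∀ u v → a u v ≡ a v u) where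

  open ℕ.≤-Reasoning

  A : (Fin n → ℕ) → Fin n → ℕ
  A f u = ∑[ v < n ] (a u v * f v)

  walksFrom : ℕ → Fin n → ℕ
  walksFrom zero    u = 1
  walksFrom (suc m) u = A (walksFrom m) u

  walks : ℕ → ℕ
  walks m = ∑[ u < n ] walksFrom m u

  trianglesAt : Fin n → ℕ
  trianglesAt v = ∑[ x < n ] ∑[ z < n ] (a v x * a v z * a x z)

  -- This moves an edge of a walk from one factor to the other, so that walks can be cut after one
  -- edge (`walks≡`) or after two (`walks≡²`).
  A-selfAdjoint : ∀ f g → ∑[ u < n ] (f u * A g u) ≡ ∑[ u < n ] (A f u * g u)
  A-selfAdjoint f g = begin-equality
    ∑[ u < n ] (f u * A g u)                    ≡⟨ ∑-cong (λ u → *-distribˡ-∑ (f u) _) ⟩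
    ∑[ u < n ] ∑[ v < n ] (f u * (a u v * g v)) ≡⟨ ∑-comm (λ u v → f u * (a u v * g v)) ⟩
    ∑[ v < n ] ∑[ u < n ] (f u * (a u v * g v))
      ≡⟨ ∑∑-cong (λ v u → trans (eq (f u) (a u v) (g v)) (cong (λ t → t * f u * g v) (a-sym u v))) ⟩
    ∑[ v < n ] ∑[ u < n ] (a v u * f u * g v)   ≡⟨ ∑-cong (λ v → *-distribʳ-∑ (g v) _) ⟨
    ∑[ u < n ] (A f u * g u)                    ∎
    where
    eq : ∀ x y z → x * (y * z) ≡ y * x * z
    eq = solve-∀

  walks≡ : ∀ m → walks (suc m) ≡ ∑[ u < n ] (walksFrom 1 u * walksFrom m u)
  walks≡ m = trans (∑-cong λ u → sym (ℕ.*-identityˡ (walksFrom (suc m) u)))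
                   (A-selfAdjoint (λ _ → 1) (walksFrom m))

  walks≡² : ∀ m → walks (suc (suc m)) ≡ ∑[ u < n ] (walksFrom 2 u * walksFrom m u)
  walks≡² m = trans (walks≡ (suc m)) (A-selfAdjoint (walksFrom 1) (walksFrom m))

  walks₁²≤ : walks 1 * walks 1 ≤ n * walks 2
  walks₁²≤ = ℕ.≤-trans (cauchy-schwarz (walksFrom 1)) (ℕ.*-monoʳ-≤ n (ℕ.≤-reflexive (sym (walks≡ 1))))

  walksFrom≤ : ∀ m u → walksFrom m u ≤ n ℕ.^ m
  walksFrom≤ zero    u = ℕ.≤-refl
  walksFrom≤ (suc m) u = ∑-≤-const λ v →
    ℕ.≤-trans (ℕ.*-mono-≤ (a≤1 u v) (walksFrom≤ m v)) (ℕ.≤-reflexive (ℕ.*-identityˡ _))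

  -- An edge xz with both ends in N(v) closes a triangle; any other edge has at
  -- most one end there.
  walksFrom₂≤ : ∀ v → 2 * walksFrom 2 v ≤ walks 1 + trianglesAt v
  walksFrom₂≤ v = begin
    2 * walksFrom 2 v
      ≡⟨ cong (λ t → walksFrom 2 v + t) (ℕ.+-identityʳ _) ⟩
    walksFrom 2 v + walksFrom 2 v
      ≡⟨ cong₂ ℕ._+_ expand (trans expand (∑-comm λ x z → a v x * a x z)) ⟩
    ∑[ x < n ] ∑[ z < n ] (a v x * a x z) + ∑[ x < n ] ∑[ z < n ] (a v z * a z x)
      ≡⟨ ∑∑-distrib-+ (λ x z → a v x * a x z) (λ x z → a v z * a z x) ⟨
    ∑[ x < n ] ∑[ z < n ] (a v x * a x z + a v z * a z x)                   ≤⟨ ∑∑-mono pointwise ⟩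
    ∑[ x < n ] ∑[ z < n ] (a x z * 1 + a v x * a v z * a x z)
      ≡⟨ ∑∑-distrib-+ (λ x z → a x z * 1) (λ x z → a v x * a v z * a x z) ⟩
    walks 1 + trianglesAt v                                                 ∎
    where
    expand : walksFrom 2 v ≡ ∑[ x < n ] ∑[ z < n ] (a v x * a x z)
    expand = ∑-cong λ x → trans (*-distribˡ-∑ (a v x) (λ z → a x z * 1))
               (∑-cong λ z → cong (a v x *_) (ℕ.*-identityʳ (a x z)))
    p+q≤1+pq : ∀ {p q} → p ≤ 1 → q ≤ 1 → p + q ≤ 1 + p * q
    p+q≤1+pq z≤n       q≤1 = q≤1
    p+q≤1+pq (s≤s z≤n) q≤1 = s≤s (ℕ.≤-reflexive (sym (ℕ.*-identityˡ _)))
    regroup : ∀ p q r → p * r + q * r ≡ (p + q) * r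
    regroup = solve-∀
    expand′ : ∀ p q r → (1 + p * q) * r ≡ r * 1 + p * q * r
    expand′ = solve-∀
    pointwise : ∀ x z → a v x * a x z + a v z * a z x ≤ a x z * 1 + a v x * a v z * a x z
    pointwise x z = begin
      a v x * a x z + a v z * a z x
        ≡⟨ cong (λ t → a v x * a x z + a v z * t) (a-sym z x) ⟩
      a v x * a x z + a v z * a x z           ≡⟨ regroup (a v x) (a v z) (a x z) ⟩
      (a v x + a v z) * a x z
        ≤⟨ ℕ.*-monoˡ-≤ (a x z) (p+q≤1+pq (a≤1 v x) (a≤1 v z)) ⟩
      (1 + a v x * a v z) * a x z             ≡⟨ expand′ (a v x) (a v z) (a x z) ⟩
      a x z * 1 + a v x * a v z * a x z       ∎

  module _ (c : ℕ) (triangles≤ : ∀ v → trianglesAt v ≤ c * n) where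

    -- Cut each walk at the vertex `v` reached after two edges and apply `walksFrom₂≤` to the short
    -- piece. The at most `c * n` triangles at `v` are each multiplied by at most `n ^ m`
    -- continuations, and there are `n` choices of `v`.
    walks-step : ∀ m → 2 * walks (suc (suc m)) ≤ walks 1 * walks m + c * n ℕ.^ suc (suc m)
    walks-step m = begin
      2 * walks (suc (suc m))                                 ≡⟨ cong (2 *_) (walks≡² m) ⟩
      2 * ∑[ v < n ] (walksFrom 2 v * walksFrom m v)          ≡⟨ *-distribˡ-∑ 2 _ ⟩
      ∑[ v < n ] (2 * (walksFrom 2 v * walksFrom m v))        ≤⟨ ∑-mono pointwise ⟩
      ∑[ v < n ] (walks 1 * walksFrom m v + c * n ℕ.^ suc m)
        ≡⟨ ∑-distrib-+ (λ v → walks 1 * walksFrom m v) (λ _ → c * n ℕ.^ suc m) ⟩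
      ∑[ v < n ] (walks 1 * walksFrom m v) + ∑[ v < n ] (c * n ℕ.^ suc m)
        ≡⟨ cong₂ ℕ._+_ (sym (*-distribˡ-∑ (walks 1) _)) (trans (∑-const n _) (eq n c (n ℕ.^ suc m))) ⟩
      walks 1 * walks m + c * n ℕ.^ suc (suc m)               ∎
      where
      eq : ∀ n c x → n * (c * x) ≡ c * (n * x)
      eq = solve-∀
      pointwise : ∀ v → 2 * (walksFrom 2 v * walksFrom m v) ≤ walks 1 * walksFrom m v + c * n ℕ.^ suc m
      pointwise v = begin
        2 * (walksFrom 2 v * walksFrom m v)                   ≡⟨ ℕ.*-assoc 2 (walksFrom 2 v) _ ⟨
        2 * walksFrom 2 v * walksFrom m v                     ≤⟨ ℕ.*-monoˡ-≤ _ (walksFrom₂≤ v) ⟩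
        (walks 1 + trianglesAt v) * walksFrom m v
          ≡⟨ ℕ.*-distribʳ-+ (walksFrom m v) (walks 1) _ ⟩
        walks 1 * walksFrom m v + trianglesAt v * walksFrom m v
          ≤⟨ ℕ.+-monoʳ-≤ _ (ℕ.*-mono-≤ (triangles≤ v) (walksFrom≤ m v)) ⟩
        walks 1 * walksFrom m v + c * n * n ℕ.^ m
          ≡⟨ cong (λ t → walks 1 * walksFrom m v + t) (ℕ.*-assoc c n _) ⟩
        walks 1 * walksFrom m v + c * n ℕ.^ suc m             ∎

    walks₀ : walks 0 ≡ n
    walks₀ = trans (∑-const n 1) (ℕ.*-identityʳ n)

    -- `bound` is a quadratic inequality in `w`. It is not solved but contradicted: if the claim
    -- fails, then `n * n ≤ 2 * w`, which turns the error term `c * n * (n * n)` into a multiple of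
    -- `w`, and what remains says that `2 * w` is below itself.
    walks₁≤ : 2 * walks 1 ≤ n * n + 2 * c * n
    walks₁≤ = ℕ.≮⇒≥ λ big → contradiction (quadratic big) (ℕ.≤⇒≯ bound)
      where
      w = walks 1
      bound : 2 * (w * w) ≤ n * (w * n + c * (n * n))
      bound = begin
        2 * (w * w)                       ≤⟨ ℕ.*-monoʳ-≤ 2 walks₁²≤ ⟩
        2 * (n * walks 2)                 ≡⟨ swap n (walks 2) ⟩
        n * (2 * walks 2)                 ≤⟨ ℕ.*-monoʳ-≤ n (walks-step 0) ⟩
        n * (w * walks 0 + c * (n * (n * 1)))
          ≡⟨ cong₂ (λ s t → n * (w * s + c * (n * t))) walks₀ (ℕ.*-identityʳ n) ⟩
        n * (w * n + c * (n * n))         ∎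
        where
        swap : ∀ x y → 2 * (x * y) ≡ x * (2 * y)
        swap = solve-∀
      quadratic : n * n + 2 * c * n < 2 * w → n * (w * n + c * (n * n)) < 2 * (w * w)
      quadratic big = begin-strict
        n * (w * n + c * (n * n))               ≡⟨ eq₁ n w c ⟩
        n * n * w + c * n * (n * n)
          ≤⟨ ℕ.+-monoʳ-≤ (n * n * w) (ℕ.*-monoʳ-≤ (c * n) (ℕ.≤-trans (ℕ.m≤m+n (n * n) _) (ℕ.<⇒≤ big))) ⟩
        n * n * w + c * n * (2 * w)             ≡⟨ eq₂ n w c ⟩
        w * (n * n + 2 * c * n)
          <⟨ ℕ.*-monoʳ-< w {{ℕ.>-nonZero (positive big)}} big ⟩
        w * (2 * w)                             ≡⟨ eq₃ w ⟩
        2 * (w * w)                             ∎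
        where
        positive : ∀ {x} → x < 2 * w → 0 < w
        positive {x} x<2w with w
        ... | zero  = contradiction x<2w λ ()
        ... | suc _ = s≤s z≤n
        eq₁ : ∀ n w c → n * (w * n + c * (n * n)) ≡ n * n * w + c * n * (n * n)
        eq₁ = solve-∀
        eq₂ : ∀ n w c → n * n * w + c * n * (2 * w) ≡ w * (n * n + 2 * c * n)
        eq₂ = solve-∀
        eq₃ : ∀ w → w * (2 * w) ≡ 2 * (w * w)
        eq₃ = solve-∀

    walks≤ : .{{NonZero n}} → ∀ m →
             2 ℕ.^ m * walks m ≤ n ℕ.^ suc m + errorConstant c m * n ℕ.^ m
    walks≤ zero = ℕ.≤-reflexive (begin-equality
      1 * walks 0   ≡⟨ ℕ.*-identityˡ (walks 0) ⟩
      walks 0       ≡⟨ walks₀ ⟩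
      n             ≡⟨ eq n ⟩
      n * 1 + 0     ∎)
      where
      eq : ∀ n → n ≡ n * 1 + 0
      eq = solve-∀
    walks≤ (suc zero) = ℕ.≤-trans walks₁≤ (ℕ.≤-reflexive (eq n c))
      where
      eq : ∀ n c → n * n + 2 * c * n ≡ n * (n * 1) + 2 * c * (n * 1)
      eq = solve-∀
    walks≤ (suc (suc m)) = begin
      2 * (2 * t) * walks (2 + m)                  ≡⟨ eq₁ t (walks (2 + m)) ⟩
      2 * t * (2 * walks (2 + m))                  ≤⟨ ℕ.*-monoʳ-≤ (2 * t) (walks-step m) ⟩
      2 * t * (walks 1 * walks m + c * (n * (n * x)))
                                                   ≡⟨ eq₂ t (walks 1) (walks m) c n x ⟩
      2 * walks 1 * (t * walks m) + 2 * t * c * (n * (n * x))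
        ≤⟨ ℕ.+-monoˡ-≤ _ (ℕ.*-mono-≤ walks₁≤ (walks≤ m)) ⟩
      (n * n + 2 * c * n) * (n * x + K * x) + 2 * t * c * (n * (n * x))
                                                   ≡⟨ eq₃ t c n x K ⟩
      n * (n * (n * x)) + (K + 2 * c + 2 * t * c) * (n * (n * x)) + 2 * c * K * (n * x)
        -- The product of the two error terms has one factor `n` too few; since `n` is nonzero it
        -- can be raised to the common power.
        ≤⟨ ℕ.+-monoʳ-≤ (n * (n * (n * x)) + (K + 2 * c + 2 * t * c) * (n * (n * x))) (ℕ.*-monoʳ-≤ (2 * c * K) (ℕ.m≤n*m (n * x) n)) ⟩
      n * (n * (n * x)) + (K + 2 * c + 2 * t * c) * (n * (n * x)) + 2 * c * K * (n * (n * x))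
                                                   ≡⟨ eq₄ t c n x K ⟩
      n * (n * (n * x)) + (K + 2 * c + 2 * c * K + 2 * t * c) * (n * (n * x)) ∎
      where
      t = 2 ℕ.^ m
      x = n ℕ.^ m
      K = errorConstant c m
      eq₁ : ∀ t w → 2 * (2 * t) * w ≡ 2 * t * (2 * w)
      eq₁ = solve-∀
      eq₂ : ∀ t w v c n x → 2 * t * (w * v + c * (n * (n * x))) ≡ 2 * w * (t * v) + 2 * t * c * (n * (n * x))
      eq₂ = solve-∀
      eq₃ : ∀ t c n x K → (n * n + 2 * c * n) * (n * x + K * x) + 2 * t * c * (n * (n * x)) ≡
                          n * (n * (n * x)) + (K + 2 * c + 2 * t * c) * (n * (n * x)) + 2 * c * K * (n * x)
      eq₃ = solve-∀
      eq₄ : ∀ t c n x K → n * (n * (n * x)) + (K + 2 * c + 2 * t * c) * (n * (n * x)) + 2 * c * K * (n * (n * x)) ≡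
                          n * (n * (n * x)) + (K + 2 * c + 2 * c * K + 2 * t * c) * (n * (n * x))
      eq₄ = solve-∀

-- Greedy paths, and sparsity of a graph without a long path

∑-𝟙-≟ : ∀ {n} (y : Fin n) → ∑[ v < n ] 𝟙 (v Fin.≟ y) ≤ 1
∑-𝟙-≟ {suc n} zero = begin
  ∑[ v < suc n ] 𝟙 (v Fin.≟ zero)  ≡⟨ ∑-suc _ ⟩
  1 + ∑[ v < n ] 0                 ≡⟨ cong suc (trans (∑-const n 0) (ℕ.*-zeroʳ n)) ⟩
  1                                ∎
  where open ℕ.≤-Reasoning
∑-𝟙-≟ {suc n} (suc y) = begin
  ∑[ v < suc n ] 𝟙 (v Fin.≟ suc y)     ≡⟨ ∑-suc _ ⟩
  ∑[ v < n ] 𝟙 (suc v Fin.≟ suc y)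
    ≡⟨ ∑-cong (λ v → 𝟙-cong (mk⇔ Fin.suc-injective (cong suc)) (suc v Fin.≟ suc y) (v Fin.≟ y)) ⟩
  ∑[ v < n ] 𝟙 (v Fin.≟ y)             ≤⟨ ∑-𝟙-≟ y ⟩
  1                                    ∎
  where open ℕ.≤-Reasoning

module _ {n : ℕ} where

  Fresh : ∀ {m} → Vec (Fin n) m → Fin n → Set
  Fresh ys v = All (v ≢_) ys

  fresh? : ∀ {m} (ys : Vec (Fin n) m) v → Dec (Fresh ys v)
  fresh? ys v = All.all? (λ y → ¬? (v Fin.≟ y)) ys

  -- Each entry of `ys` spoils at most one candidate. The loss is added on the right, which avoids
  -- truncated subtraction.
  fresh-count : {Q : Fin n → Set} (Q? : ∀ v → Dec (Q v)) → ∀ {m} (ys : Vec (Fin n) m) →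
                ∑[ v < n ] 𝟙 (Q? v) ≤ ∑[ v < n ] 𝟙 (Q? v ×-dec fresh? ys v) + m
  fresh-count Q? [] = ℕ.≤-trans
    (ℕ.≤-reflexive (∑-cong λ v → 𝟙-cong (mk⇔ (_, []) proj₁) (Q? v) (Q? v ×-dec fresh? [] v)))
    (ℕ.m≤m+n _ 0)
  fresh-count Q? {suc m} (y ∷ ys) = begin
    ∑[ v < n ] 𝟙 (Q? v)                                         ≤⟨ fresh-count Q? ys ⟩
    ∑[ v < n ] 𝟙 (Q? v ×-dec fresh? ys v) + m                   ≤⟨ ℕ.+-monoˡ-≤ m (∑-mono split) ⟩
    ∑[ v < n ] (𝟙 (Q? v ×-dec fresh? (y ∷ ys) v) + 𝟙 (v Fin.≟ y)) + m
      ≡⟨ cong (λ t → t + m) (∑-distrib-+ _ _) ⟩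
    (t + ∑[ v < n ] 𝟙 (v Fin.≟ y)) + m
      ≤⟨ ℕ.+-monoˡ-≤ m (ℕ.+-monoʳ-≤ t (∑-𝟙-≟ y)) ⟩
    (t + 1) + m                                                 ≡⟨ ℕ.+-assoc t 1 m ⟩
    t + suc m                                                   ∎
    where
    open ℕ.≤-Reasoning
    t = ∑[ v < n ] 𝟙 (Q? v ×-dec fresh? (y ∷ ys) v)
    split : ∀ v → 𝟙 (Q? v ×-dec fresh? ys v) ≤ 𝟙 (Q? v ×-dec fresh? (y ∷ ys) v) + 𝟙 (v Fin.≟ y)
    split v with Q? v | v Fin.≟ y | fresh? ys v
    ... | no _  | _     | _     = z≤n
    ... | yes _ | no _  | no _  = z≤n
    ... | yes _ | no _  | yes _ = ℕ.≤-refl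
    ... | yes _ | yes _ | no _  = z≤n
    ... | yes _ | yes _ | yes _ = ℕ.≤-refl

  ∑-𝟙-positive : {Q : Fin n → Set} (Q? : ∀ v → Dec (Q v)) → 0 < ∑[ v < n ] 𝟙 (Q? v) → ∃ Q
  ∑-𝟙-positive Q? pos with Fin.any? Q?
  ... | yes q = q
  ... | no ¬q = contradiction (ℕ.<-≤-trans pos (ℕ.≤-trans
    (∑-≤-const {c = 0} λ v → ℕ.≤-reflexive (𝟙-no (λ q → ¬q (v , q)) (Q? v)))
    (ℕ.≤-reflexive (ℕ.*-zeroʳ n)))) λ ()

  fresh-exists : {Q : Fin n → Set} (Q? : ∀ v → Dec (Q v)) → ∀ {m} (ys : Vec (Fin n) m) →
                 m < ∑[ v < n ] 𝟙 (Q? v) → ∃[ v ] Q v × Fresh ys v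
  fresh-exists Q? {m} ys m< = ∑-𝟙-positive (λ v → Q? v ×-dec fresh? ys v)
    (ℕ.+-cancelʳ-< m 0 _ (ℕ.<-≤-trans m< (fresh-count Q? ys)))

IsPath : ∀ {n m} → Rel (Fin n) 0ℓ → Vec (Fin n) m → Set
IsPath B ys = Linked.Linked B ys × Unique ys

-- Iterate "keep the vertices with more than q neighbours among those kept so
-- far" q times.  A survivor starts a path on suc q vertices, found greedily,
-- and each round destroys at most q edges per discarded vertex.
module Pruning {n : ℕ} {B : Rel (Fin n) 0ℓ} (B? : Decidable B) (B-sym : Symmetric B) (q : ℕ) where

  open ℕ.≤-Reasoning

  Alive : ℕ → Fin n → Set
  alive? : ∀ i u → Dec (Alive i u)
  Alive zero    u = ⊤
  Alive (suc i) u = q < ∑[ v < n ] 𝟙 (B? u v ×-dec alive? i v)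
  alive? zero    u = yes tt
  alive? (suc i) u = q ℕ.<? ∑[ v < n ] 𝟙 (B? u v ×-dec alive? i v)

  -- A vertex alive at level `suc i` has more than `q` neighbours alive at level `i`, so each new
  -- vertex costs one level. The budget `i + j ≤ q` keeps the number of vertices already used at
  -- most `q` whenever a step is taken, so some neighbour is new.
  extend : ∀ i {j} (x : Fin n) (ys : Vec (Fin n) j) → i + j ≤ q → Alive i x → IsPath B (x ∷ ys) →
           ∃[ zs ] IsPath {m = i + suc j} B zs
  extend zero    x ys _      _     path = x ∷ ys , path
  extend (suc i) {j} x ys 1+i+j≤q alive path
    with v , (Bxv , v-alive) , v-fresh ←
      fresh-exists (λ v → B? x v ×-dec alive? i v) (x ∷ ys) (ℕ.≤-<-trans (ℕ.≤-trans (s≤s (ℕ.m≤n+m j i)) 1+i+j≤q) alive)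
    = subst (λ k → ∃[ zs ] IsPath {m = k} B zs) (ℕ.+-suc i (suc j))
        (extend i v (x ∷ ys) (subst (_≤ q) (sym (ℕ.+-suc i j)) 1+i+j≤q) v-alive
          (B-sym Bxv ∷ proj₁ path , v-fresh ∷ proj₂ path))

  b : Fin n → Fin n → ℕ
  b u v = 𝟙 (B? u v)

  alive : ℕ → Fin n → ℕ
  alive i u = 𝟙 (alive? i u)

  dead : ℕ → Fin n → ℕ
  dead i u = 𝟙 (¬? (alive? i u))

  edges : ℕ → ℕ
  edges i = ∑[ u < n ] ∑[ v < n ] (b u v * (alive i u * alive i v))

  dead-degree : ∀ i u → ∑[ v < n ] (dead (suc i) u * (b u v * alive i v)) ≤ q
  dead-degree i u = begin
    ∑[ v < n ] (dead (suc i) u * (b u v * alive i v))          ≡⟨ *-distribˡ-∑ (dead (suc i) u) _ ⟨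
    dead (suc i) u * ∑[ v < n ] (b u v * alive i v)
      ≡⟨ cong (λ t → dead (suc i) u * t) (∑-cong λ v → 𝟙-× (B? u v) (alive? i v)) ⟨
    dead (suc i) u * ∑[ v < n ] 𝟙 (B? u v ×-dec alive? i v)    ≤⟨ bound _ (alive? (suc i) u) ⟩
    q                                                          ∎
    where
    bound : ∀ s (q<?s : Dec (q < s)) → 𝟙 (¬? q<?s) * s ≤ q
    bound s (yes _)   = z≤n
    bound s (no  q≮s) = ℕ.≤-trans (ℕ.≤-reflexive (ℕ.*-identityˡ s)) (ℕ.≮⇒≥ q≮s)

  -- `edges` counts ordered pairs. A pair lost in this round is charged to an end that is dead at
  -- `suc i`: `left` charges the first vertex, `right` the second, and each charge totals at most
  -- `n * q` by `dead-degree`.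
  edges-step : ∀ i → edges i ≤ edges (suc i) + (n * q + n * q)
  edges-step i = begin
    edges i
      ≤⟨ ∑∑-mono (λ u v → split (alive? (suc i) u) (alive? (suc i) v) (b u v) (𝟙≤1 (alive? i u)) (𝟙≤1 (alive? i v))) ⟩
    ∑[ u < n ] ∑[ v < n ] (b u v * (alive (suc i) u * alive (suc i) v) + (left u v + right u v))
      ≡⟨ ∑∑-distrib-+ (λ u v → b u v * (alive (suc i) u * alive (suc i) v)) _ ⟩
    edges (suc i) + ∑[ u < n ] ∑[ v < n ] (left u v + right u v)
      ≡⟨ cong (λ t → edges (suc i) + t) (∑∑-distrib-+ left right) ⟩
    edges (suc i) + (∑[ u < n ] ∑[ v < n ] left u v + ∑[ u < n ] ∑[ v < n ] right u v)
      ≤⟨ ℕ.+-monoʳ-≤ (edges (suc i)) (ℕ.+-mono-≤ (∑-≤-const (dead-degree i)) right≤) ⟩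
    edges (suc i) + (n * q + n * q) ∎
    where
    left right : Fin n → Fin n → ℕ
    left  u v = dead (suc i) u * (b u v * alive i v)
    right u v = dead (suc i) v * (b u v * alive i u)
    b-sym : ∀ u v → b u v ≡ b v u
    b-sym u v = 𝟙-cong (mk⇔ B-sym B-sym) (B? u v) (B? v u)
    right≤ : ∑[ u < n ] ∑[ v < n ] right u v ≤ n * q
    right≤ = begin
      ∑[ u < n ] ∑[ v < n ] right u v   ≡⟨ ∑-comm right ⟩
      ∑[ v < n ] ∑[ u < n ] right u v
        ≡⟨ ∑∑-cong (λ v u → cong (λ t → dead (suc i) v * (t * alive i u)) (b-sym u v)) ⟩
      ∑[ v < n ] ∑[ u < n ] left v u    ≤⟨ ∑-≤-const (dead-degree i) ⟩
      n * q                             ∎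
    split : {A C : Set} (A? : Dec A) (C? : Dec C) → ∀ b {x y} → x ≤ 1 → y ≤ 1 →
            b * (x * y) ≤ b * (𝟙 A? * 𝟙 C?) + (𝟙 (¬? A?) * (b * y) + 𝟙 (¬? C?) * (b * x))
    split (yes _) (yes _) b x≤1 y≤1 = ℕ.≤-trans (ℕ.*-monoʳ-≤ b (ℕ.*-mono-≤ x≤1 y≤1)) (ℕ.m≤m+n (b * 1) 0)
    split (no _) _ b {x} {y} x≤1 _ = begin
      b * (x * y)                 ≤⟨ ℕ.*-monoʳ-≤ b (ℕ.*-monoˡ-≤ y x≤1) ⟩
      b * (1 * y)                 ≡⟨ cong (λ t → b * t) (ℕ.*-identityˡ y) ⟩
      b * y                       ≡⟨ ℕ.*-identityˡ (b * y) ⟨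
      1 * (b * y)                 ≤⟨ ℕ.m≤m+n (1 * (b * y)) _ ⟩
      1 * (b * y) + _             ≤⟨ ℕ.m≤n+m _ (b * 0) ⟩
      b * 0 + (1 * (b * y) + _)   ∎
    split (yes _) (no _) b {x} {y} _ y≤1 = begin
      b * (x * y)                 ≤⟨ ℕ.*-monoʳ-≤ b (ℕ.*-monoʳ-≤ x y≤1) ⟩
      b * (x * 1)                 ≡⟨ cong (λ t → b * t) (ℕ.*-identityʳ x) ⟩
      b * x                       ≡⟨ ℕ.*-identityˡ (b * x) ⟨
      1 * (b * x)                 ≤⟨ ℕ.m≤n+m (1 * (b * x)) (b * 0) ⟩
      b * 0 + (1 * (b * x))       ∎

  edges-iterate : ∀ i → edges 0 ≤ edges i + i * (n * q + n * q)
  edges-iterate zero    = ℕ.m≤m+n (edges 0) 0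
  edges-iterate (suc i) = begin
    edges 0                                                        ≤⟨ edges-iterate i ⟩
    edges i + i * (n * q + n * q)                                  ≤⟨ ℕ.+-monoˡ-≤ _ (edges-step i) ⟩
    edges (suc i) + (n * q + n * q) + i * (n * q + n * q)
      ≡⟨ ℕ.+-assoc (edges (suc i)) (n * q + n * q) _ ⟩
    edges (suc i) + suc i * (n * q + n * q)                        ∎

  sparse : ¬ (∃[ zs ] IsPath {m = suc q} B zs) →
           ∑[ u < n ] ∑[ v < n ] 𝟙 (B? u v) ≤ q * (q + q) * n
  sparse pathless = begin
    ∑[ u < n ] ∑[ v < n ] b u v   ≡⟨ ∑∑-cong (λ u v → ℕ.*-identityʳ (b u v)) ⟨
    edges 0                       ≤⟨ edges-iterate q ⟩
    edges q + q * (n * q + n * q) ≤⟨ ℕ.+-monoˡ-≤ (q * (n * q + n * q)) no-edges ⟩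
    0 + q * (n * q + n * q)       ≡⟨ eq n q ⟩
    q * (q + q) * n               ∎
    where
    eq : ∀ n q → 0 + q * (n * q + n * q) ≡ q * (q + q) * n
    eq = solve-∀
    none-alive : ∀ u → ¬ Alive q u
    none-alive u u-alive = pathless (subst (λ k → ∃[ zs ] IsPath {m = k} B zs) (ℕ.+-comm q 1)
      (extend q u [] (ℕ.≤-reflexive (ℕ.+-identityʳ q)) u-alive ([-] , [] ∷ [])))
    no-edges : edges q ≤ 0
    no-edges = begin
      edges q
        ≡⟨ ∑∑-cong (λ u v → trans (cong (λ t → b u v * (t * alive q v)) (𝟙-no (none-alive u) (alive? q u))) (ℕ.*-zeroʳ (b u v))) ⟩
      ∑[ u < n ] ∑[ v < n ] 0
        ≡⟨ trans (∑-cong λ u → trans (∑-const n 0) (ℕ.*-zeroʳ n)) (trans (∑-const n 0) (ℕ.*-zeroʳ n)) ⟩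
      0                           ∎

-- Comparing and counting finite lists

module _ {A B : Set} {R : A → B → Set} where

  -- An injection presented as a relation, so that no canonical partner has to be chosen. After one
  -- occurrence of the partner of the head is deleted from `ys`, the tail still has its partners,
  -- because that element is related to the head alone.
  length-≤-relation : ∀ {xs ys} → List.Unique xs →
                      (∀ {x} → x List.∈ xs → ∃[ y ] y List.∈ ys × R x y) →
                      (∀ {x x′ y} → R x y → R x′ y → x ≡ x′) →
                      length xs ≤ length ys
  length-≤-relation {[]}     _ _ _ = z≤n
  length-≤-relation {x ∷ xs} {ys} (x∉xs ListAllPairs.∷ xs!) partner functional
    with y , y∈ys , Rxy ← partner (here refl)
    with as , bs , refl ← List.∈-∃++ y∈ys = begin
    suc (length xs)             ≤⟨ s≤s (length-≤-relation xs! partner′ functional) ⟩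
    suc (length (as ++ bs))     ≡⟨ cong suc (List.length-++ as) ⟩
    suc (length as + length bs) ≡⟨ ℕ.+-suc (length as) (length bs) ⟨
    length as + suc (length bs) ≡⟨ List.length-++ as ⟨
    length (as ++ y ∷ bs)       ∎
    where
    open ℕ.≤-Reasoning
    partner′ : ∀ {x′} → x′ List.∈ xs → ∃[ z ] z List.∈ as ++ bs × R x′ z
    partner′ x′∈xs with z , z∈ , Rx′z ← partner (there x′∈xs) with List.∈-++⁻ as z∈
    ... | inj₁ z∈as         = z , List.∈-++⁺ˡ z∈as , Rx′z
    ... | inj₂ (there z∈bs) = z , List.∈-++⁺ʳ as z∈bs , Rx′z
    ... | inj₂ (here refl)  = contradiction (functional Rxy Rx′z) (ListAll.lookup x∉xs x′∈xs)

bools : List Bool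
bools = true ∷ false ∷ []

bools-unique : List.Unique bools
bools-unique = ((λ ()) ListAll.∷ ListAll.[]) ListAllPairs.∷ ListAll.[] ListAllPairs.∷ ListAllPairs.[]

bools-complete : ∀ b → b List.∈ bools
bools-complete true  = here refl
bools-complete false = there (here refl)

length-cartesianProduct : {A B : Set} (xs : List A) (ys : List B) →
                          length (List.cartesianProduct xs ys) ≡ length xs * length ys
length-cartesianProduct []       ys = refl
length-cartesianProduct {A} {B} (x ∷ xs) ys = begin
  length (List.map pair ys ++ List.cartesianProduct xs ys)
    ≡⟨ List.length-++ (List.map pair ys) ⟩
  length (List.map pair ys) + length (List.cartesianProduct xs ys)
    ≡⟨ cong₂ ℕ._+_ (List.length-map pair ys) (length-cartesianProduct xs ys) ⟩
  length ys + length xs * length ys                                ∎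
  where
  open ≡-Reasoning
  pair : B → A × B
  pair y = x , y

module _ {A B : Set} {R : Bool × A → B → Set} {Q : A → Set} {W : B → Set}
         (Q? : ∀ x → Dec (Q x)) (W? : ∀ y → Dec (W y)) {xs : List A} {ys : List B} where

  private
    pairs : List (Bool × A)
    pairs = List.cartesianProduct bools (filter Q? xs)

  -- A Boolean tag carries the factor 2. The same relation `R` is read from tagged elements to `ys`
  -- here, and backwards in `filter≤2*filter`.
  2*filter≤filter : List.Unique xs → (∀ y → y List.∈ ys) →
                    (∀ {b x} → Q x → ∃[ y ] W y × R (b , x) y) →
                    (∀ {p p′ y} → R p y → R p′ y → p ≡ p′) →
                    2 * length (filter Q? xs) ≤ length (filter W? ys)
  2*filter≤filter xs! ys-complete exists functional =
    subst (_≤ length (filter W? ys)) (length-cartesianProduct bools (filter Q? xs))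
      (length-≤-relation {R = R} (List.cartesianProduct⁺ bools-unique (List.filter⁺ Q? xs!)) partner functional)
    where
    partner : ∀ {p} → p List.∈ pairs → ∃[ y ] y List.∈ filter W? ys × R p y
    partner p∈ with _ , x∈ ← List.∈-cartesianProduct⁻ bools (filter Q? xs) p∈
               with y , w , r ← exists (proj₂ (List.∈-filter⁻ Q? {xs = xs} x∈))
      = y , List.∈-filter⁺ W? (ys-complete y) w , r

  filter≤2*filter : List.Unique ys → (∀ x → x List.∈ xs) →
                    (∀ {y} → W y → ∃[ b ] ∃[ x ] Q x × R (b , x) y) →
                    (∀ {p y y′} → R p y → R p y′ → y ≡ y′) →
                    length (filter W? ys) ≤ 2 * length (filter Q? xs)
  filter≤2*filter ys! xs-complete exists unique =
    subst (length (filter W? ys) ≤_) (length-cartesianProduct bools (filter Q? xs))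
      (length-≤-relation {R = λ y p → R p y} (List.filter⁺ W? ys!) partner unique)
    where
    partner : ∀ {y} → y List.∈ filter W? ys → ∃[ p ] p List.∈ pairs × R p y
    partner y∈ with b , x , q , r ← exists (proj₂ (List.∈-filter⁻ W? {xs = ys} y∈))
      = (b , x) , List.∈-cartesianProduct⁺ (bools-complete b) (List.∈-filter⁺ Q? (xs-complete x) q) , r

module _ {A B : Set} {Q : B → Set} (Q? : ∀ y → Dec (Q y)) (f : A → B) where

  length-filter-map : ∀ xs → length (filter Q? (List.map f xs)) ≡ length (filter (Q? ∘ f) xs)
  length-filter-map []       = refl
  length-filter-map (x ∷ xs) with does (Q? (f x))
  ... | true  = cong suc (length-filter-map xs)
  ... | false = length-filter-map xs

module _ {A B C : Set} {Q : C → Set} (Q? : ∀ z → Dec (Q z)) (f : A → B → C) (ys : List B) where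

  length-filter-product : ∀ {n} (g : Fin n → A) →
    length (filter Q? (cartesianProductWith f (List.tabulate g) ys)) ≡
    ∑[ i < n ] length (filter (Q? ∘ f (g i)) ys)
  length-filter-product {zero}  g = sym (∑-zero _)
  length-filter-product {suc n} g = begin
    length (filter Q? (List.map (f (g zero)) ys ++ rest))
      ≡⟨ cong length (List.filter-++ Q? (List.map (f (g zero)) ys) rest) ⟩
    length (filter Q? (List.map (f (g zero)) ys) ++ filter Q? rest)
      ≡⟨ List.length-++ (filter Q? (List.map (f (g zero)) ys)) ⟩
    length (filter Q? (List.map (f (g zero)) ys)) + length (filter Q? rest)
      ≡⟨ cong₂ ℕ._+_ (length-filter-map Q? (f (g zero)) ys) (length-filter-product (g ∘ suc)) ⟩
    length (filter (Q? ∘ f (g zero)) ys) + ∑[ i < n ] length (filter (Q? ∘ f (g (suc i))) ys)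
      ≡⟨ ∑-suc _ ⟨
    ∑[ i < suc n ] length (filter (Q? ∘ f (g i)) ys) ∎
    where
    open ≡-Reasoning
    rest = cartesianProductWith f (List.tabulate (g ∘ suc)) ys

count : ∀ {n m} {Q : Vec (Fin n) m → Set} → (∀ y → Dec (Q y)) → ℕ
count Q? = length (filter Q? (vectors (allFin _) _))

module _ {n m : ℕ} {Q : Vec (Fin n) (suc m) → Set} (Q? : ∀ y → Dec (Q y)) where

  count-suc : count Q? ≡ ∑[ v < n ] count (λ y → Q? (v ∷ y))
  count-suc = length-filter-product Q? _∷_ (vectors (allFin n) m) id

  count-extend : {Q′ : Vec (Fin n) m → Set} (Q′? : ∀ y → Dec (Q′ y)) → ∀ {c} →
                 (∀ y → Q′ y → c ≤ ∑[ v < n ] 𝟙 (Q? (v ∷ y))) → count Q′? * c ≤ count Q?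
  count-extend {Q′} Q′? {c} extensions =
    ℕ.≤-trans (go (vectors (allFin n) m)) (ℕ.≤-reflexive (sym count-suc))
    where
    open ℕ.≤-Reasoning
    length-filter-∷ : {A : Set} {S : A → Set} (S? : ∀ y → Dec (S y)) → ∀ y ys →
                      length (filter S? (y ∷ ys)) ≡ 𝟙 (S? y) + length (filter S? ys)
    length-filter-∷ S? y ys with does (S? y)
    ... | true  = refl
    ... | false = refl
    go : ∀ ys → length (filter Q′? ys) * c ≤ ∑[ v < n ] length (filter (λ y → Q? (v ∷ y)) ys)
    go []       = z≤n
    go (y ∷ ys) = begin
      length (filter Q′? (y ∷ ys)) * c            ≡⟨ cong (λ t → t * c) (length-filter-∷ Q′? y ys) ⟩
      (𝟙 (Q′? y) + length (filter Q′? ys)) * c    ≡⟨ ℕ.*-distribʳ-+ c (𝟙 (Q′? y)) _ ⟩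
      𝟙 (Q′? y) * c + length (filter Q′? ys) * c  ≤⟨ ℕ.+-mono-≤ (first (Q′? y)) (go ys) ⟩
      ∑[ v < n ] 𝟙 (Q? (v ∷ y)) + ∑[ v < n ] length (filter (λ y → Q? (v ∷ y)) ys)
                                                  ≡⟨ ∑-distrib-+ _ _ ⟨
      ∑[ v < n ] (𝟙 (Q? (v ∷ y)) + length (filter (λ y → Q? (v ∷ y)) ys))
        ≡⟨ ∑-cong (λ v → length-filter-∷ (λ y → Q? (v ∷ y)) y ys) ⟨
      ∑[ v < n ] length (filter (λ y → Q? (v ∷ y)) (y ∷ ys)) ∎
      where
      first : (d : Dec (Q′ y)) → 𝟙 d * c ≤ ∑[ v < n ] 𝟙 (Q? (v ∷ y))
      first (yes q) = ℕ.≤-trans (ℕ.≤-reflexive (ℕ.*-identityˡ c)) (extensions y q)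
      first (no _)  = z≤n

module _ {n : ℕ} {Q : Fin n → Set} (Q? : ∀ v → Dec (Q v)) where

  subset : Subset n
  subset = tabulate (does ∘ Q?)

  subset⁺ : ∀ {v} → Q v → v ∈ subset
  subset⁺ {v} q = lookup⇒[]= v subset (trans (lookup∘tabulate _ v) (dec-true (Q? v) q))

  subset⁻ : ∀ {v} → v ∈ subset → Q v
  subset⁻ {v} v∈ with Q? v | trans (sym (lookup∘tabulate (does ∘ Q?) v)) ([]=⇒lookup v∈)
  ... | yes q | _ = q

-- Copies as images of injective homomorphisms

edge? : ∀ {n} (G : Graph n) u v → Dec (Edge G u v)
edge? G u v = v ∈? lookup (Graph.adjacency G) u

module _ {h n : ℕ} (H : Graph h) (G : Graph n) (f : Fin h → Fin n)
         (f-injective : Injective _≡_ _≡_ f) (f-edge : ∀ {i j} → Edge H i j → Edge G (f i) (f j)) where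

  -- The edges of the copy are only the images of edges of `H`, not all edges of `G` between image
  -- vertices: copies need not be induced.
  image : ∃[ S ] IsSubgraph G S × IsIsomorphism H S f
  image = (subset V? , matrix E?) , record
    { symmetric = λ u v e → matrix⁺ E? (flip (matrix⁻ E? e))
    ; endpoint  = λ u v e → subset⁺ V? (start (matrix⁻ E? e))
    ; edge      = λ u v e → within (matrix⁻ E? e)
    } , record
    { injective = f-injective
    ; into      = λ i → subset⁺ V? (i , refl)
    ; onto      = λ w → subset⁻ V?
    ; edge      = λ i j → mk⇔ (λ e → matrix⁺ E? (i , j , refl , refl , e)) (λ e → pull (matrix⁻ E? e))
    }
    where
    V : Fin n → Set
    V w = ∃[ i ] f i ≡ w
    V? : ∀ w → Dec (V w)
    V? w = Fin.any? λ i → f i Fin.≟ w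
    E : Rel (Fin n) 0ℓ
    E u v = ∃[ i ] ∃[ j ] f i ≡ u × f j ≡ v × Edge H i j
    E? : Decidable E
    E? u v = Fin.any? λ i → Fin.any? λ j → f i Fin.≟ u ×-dec f j Fin.≟ v ×-dec edge? H i j
    flip : ∀ {u v} → E u v → E v u
    flip (i , j , fi≡u , fj≡v , e) = j , i , fj≡v , fi≡u , Graph.symmetric H e
    start : ∀ {u v} → E u v → V u
    start (i , _ , fi≡u , _) = i , fi≡u
    within : ∀ {u v} → E u v → Edge G u v
    within (_ , _ , refl , refl , e) = f-edge e
    pull : ∀ {i j} → E (f i) (f j) → Edge H i j
    pull (_ , _ , fi′≡fi , fj′≡fj , e) = subst₂ (Edge H) (f-injective fi′≡fi) (f-injective fj′≡fj) e

module _ {h n : ℕ} {H : Graph h} {G : Graph n} {f : Fin h → Fin n} where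

  private
    vertices-⊆ : ∀ {S S′} → IsIsomorphism H S f → IsIsomorphism H S′ f →
                 ∀ {w} → w ∈ proj₁ S → w ∈ proj₁ S′
    vertices-⊆ {S′ = S′} I I′ {w} w∈ with i , fi≡w ← IsIsomorphism.onto I w w∈ =
      subst (_∈ proj₁ S′) fi≡w (IsIsomorphism.into I′ i)

    edges-⊆ : ∀ {S S′} → IsSubgraph G S → IsIsomorphism H S f → IsIsomorphism H S′ f →
              ∀ {u v} → proj₂ S ⟨ u ⇢ v ⟩ → proj₂ S′ ⟨ u ⇢ v ⟩
    edges-⊆ S⊆G I I′ {u} {v} e
      with i , refl ← IsIsomorphism.onto I u (IsSubgraph.endpoint S⊆G u v e)
         | j , refl ← IsIsomorphism.onto I v (IsSubgraph.endpoint S⊆G v u (IsSubgraph.symmetric S⊆G u v e))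
      = to (IsIsomorphism.edge I′ i j) (from (IsIsomorphism.edge I i j) e)

  -- By `endpoint` and `symmetric`, both ends of an edge of `S` are vertices of `S`, hence values of
  -- `f`. So vertices and edges alike are read off from `f` and `H`.
  isomorphism-determines : ∀ {S S′} → IsSubgraph G S → IsSubgraph G S′ →
                           IsIsomorphism H S f → IsIsomorphism H S′ f → S ≡ S′
  isomorphism-determines {W , E} {W′ , E′} S⊆G S′⊆G I I′ = cong₂ _,_
    (⊆-antisym (vertices-⊆ I I′) (vertices-⊆ I′ I))
    (begin
      E                    ≡⟨ tabulate∘lookup E ⟨
      tabulate (lookup E)
        ≡⟨ tabulate-cong (λ u → ⊆-antisym (edges-⊆ S⊆G I I′) (edges-⊆ S′⊆G I′ I)) ⟩
      tabulate (lookup E′) ≡⟨ tabulate∘lookup E′ ⟩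
      E′                   ∎)
    where open ≡-Reasoning

lookup-consecutive : ∀ {A : Set} {R : Rel A 0ℓ} {m} {ys : Vec A m} → Linked.Linked R ys →
                     ∀ {i j} → suc (toℕ i) ≡ toℕ j → R (lookup ys i) (lookup ys j)
lookup-consecutive {ys = _ ∷ _ ∷ _} (r ∷ rs) {zero}  {suc zero} _  = r
lookup-consecutive {ys = _ ∷ _ ∷ _} (r ∷ rs) {suc i} {suc j}    eq = lookup-consecutive rs (ℕ.suc-injective eq)

linked-tabulate : ∀ {A : Set} {R : Rel A 0ℓ} {m} {f : Fin m → A} →
                  (∀ {i j} → suc (toℕ i) ≡ toℕ j → R (f i) (f j)) → Linked.Linked R (tabulate f)
linked-tabulate {m = zero}        r = Linked.[]
linked-tabulate {m = suc zero}    r = [-]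
linked-tabulate {m = suc (suc m)} r = r refl ∷ linked-tabulate (λ eq → r (cong suc eq))

P-edge : ∀ l {i j} → Edge (P l) i j ⇔ (i ≢ j × (suc (toℕ i) ≡ toℕ j ⊎ suc (toℕ j) ≡ toℕ i))
P-edge l = fromRel-edge {R = λ i j → suc (toℕ i) ≡ toℕ j} (λ i j → suc (toℕ i) ℕ.≟ toℕ j)

P-consecutive : ∀ l {i j} → suc (toℕ i) ≡ toℕ j → Edge (P l) i j
P-consecutive l eq = from (P-edge l) ((λ { refl → ℕ.1+n≢n eq }) , inj₁ eq)

C-edge : ∀ k .{{_ : NonZero k}} {i j} →
         Edge (C k) i j ⇔ (i ≢ j × (suc (toℕ i) % k ≡ toℕ j ⊎ suc (toℕ j) % k ≡ toℕ i))
C-edge k = fromRel-edge {R = λ i j → suc (toℕ i) % k ≡ toℕ j} (λ i j → suc (toℕ i) % k ℕ.≟ toℕ j)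

module _ {n : ℕ} (G : Graph n) where

  path-image : ∀ {l} {ys : Vec (Fin n) l} → IsPath (Edge G) ys →
               ∃[ S ] IsSubgraph G S × IsIsomorphism (P l) S (lookup ys)
  path-image {l} {ys} (linked , unique) =
    image (P l) G (lookup ys) (λ {i} {j} → lookup-injective unique i j) λ e → edge (proj₂ (to (P-edge l) e))
    where
    edge : ∀ {i j} → suc (toℕ i) ≡ toℕ j ⊎ suc (toℕ j) ≡ toℕ i → Edge G (lookup ys i) (lookup ys j)
    edge (inj₁ eq) = lookup-consecutive linked eq
    edge (inj₂ eq) = Graph.symmetric G (lookup-consecutive linked eq)

  cycle-image : ∀ {m} {ys : Vec (Fin n) (suc m)} → IsPath (Edge G) ys →
                Edge G (lookup ys (Fin.fromℕ m)) (lookup ys zero) → ∃ (IsCopy (C (suc m)) G)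
  cycle-image {m} {ys} (linked , unique) closing =
    let S , S⊆G , I = image (C (suc m)) G (lookup ys) (λ {i} {j} → lookup-injective unique i j)
                        λ e → edge (proj₂ (to (C-edge (suc m)) e))
    in S , S⊆G , lookup ys , I
    where
    step : ∀ {i j} → suc (toℕ i) % suc m ≡ toℕ j → Edge G (lookup ys i) (lookup ys j)
    step {i} {j} eq with suc (toℕ i) ℕ.<? suc m
    ... | yes i<m = lookup-consecutive linked (trans (sym (m<n⇒m%n≡m i<m)) eq)
    -- Now `i` is the last vertex and the remainder wraps to 0, so this is the closing edge.
    ... | no  i≮m = subst₂ (λ i j → Edge G (lookup ys i) (lookup ys j)) (sym i≡m) (sym j≡0) closing
      where
      toℕi≡m : toℕ i ≡ m
      toℕi≡m = ℕ.≤-antisym (ℕ.≤-pred (Fin.toℕ<n i)) (ℕ.≤-pred (ℕ.≮⇒≥ i≮m))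
      i≡m : i ≡ Fin.fromℕ m
      i≡m = Fin.toℕ-injective (trans toℕi≡m (sym (Fin.toℕ-fromℕ m)))
      j≡0 : j ≡ zero
      j≡0 = Fin.toℕ-injective (trans (sym eq) (trans (cong (λ t → suc t % suc m) toℕi≡m) (n%n≡0 (suc m))))
    edge : ∀ {i j} → suc (toℕ i) % suc m ≡ toℕ j ⊎ suc (toℕ j) % suc m ≡ toℕ i →
           Edge G (lookup ys i) (lookup ys j)
    edge (inj₁ eq) = step eq
    edge (inj₂ eq) = Graph.symmetric G (step eq)

  isWalk? : ∀ {m} (y : Vec (Fin n) m) → Dec (Linked.Linked (Edge G) y)
  isWalk? = Linked.linked? (edge? G)

  isPath? : ∀ {m} (y : Vec (Fin n) m) → Dec (IsPath (Edge G) y)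
  isPath? y = isWalk? y ×-dec AllPairs.allPairs? (λ u v → ¬? (u Fin.≟ v)) y

-- The two traversals of a copy of a path

does-complement : {A B : Set} (A? : Dec A) (B? : Dec B) → (A → ¬ B) → (¬ A → B) →
                  does A? ≡ not (does B?)
does-complement (yes a) (yes b) A⇒¬B _ = contradiction b (A⇒¬B a)
does-complement (yes _) (no _)  _    _ = refl
does-complement (no _)  (yes _) _    _ = refl
does-complement (no ¬a) (no ¬b) _ ¬A⇒B = contradiction (¬A⇒B ¬a) ¬b

-- For l ≥ 2 each copy of P l is traversed by exactly two vectors of vertices,
-- told apart by which end has the smaller index.
module _ {n m : ℕ} (G : Graph n) where

  private
    l : ℕ
    l = suc (suc m)

    last : Fin l
    last = Fin.fromℕ (suc m)

  ascending : (Fin l → Fin n) → Bool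
  ascending f = does (f zero Fin.<? f last)

  ascending-cong : ∀ {f g} → f ≗ g → ascending f ≡ ascending g
  ascending-cong f≗g = cong₂ (λ u v → does (u Fin.<? v)) (f≗g zero) (f≗g last)

  reversed : (Fin l → Fin n) → Fin l → Fin n
  reversed f = f ∘ Fin.opposite

  ascending-reversed : ∀ f → f zero ≢ f last → ascending (reversed f) ≡ not (ascending f)
  ascending-reversed f f0≢fl
    -- `Fin.opposite zero` reduces to `last`, so the rewrite turns the value of `reversed f` at
    -- `last` into `f zero`.
    rewrite Fin.opposite-involutive {suc (suc m)} zero
    = does-complement (f last Fin.<? f zero) (f zero Fin.<? f last) ℕ.<-asym
        λ fl≮f0 → ℕ.≤∧≢⇒< (ℕ.≮⇒≥ fl≮f0) (f0≢fl ∘ Fin.toℕ-injective)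

  private
    opposite-consecutive : ∀ {i j : Fin l} → suc (toℕ i) ≡ toℕ j →
                           suc (toℕ (Fin.opposite j)) ≡ toℕ (Fin.opposite i)
    opposite-consecutive {i} {j} eq = begin
      suc (toℕ (Fin.opposite j))      ≡⟨ cong suc (Fin.opposite-prop j) ⟩
      suc (l ∸ suc (toℕ j))           ≡⟨ ℕ.+-∸-assoc 1 (Fin.toℕ<n j) ⟨
      l ∸ toℕ j                       ≡⟨ cong (λ t → l ∸ t) eq ⟨
      l ∸ suc (toℕ i)                 ≡⟨ Fin.opposite-prop i ⟨
      toℕ (Fin.opposite i)            ∎
      where open ≡-Reasoning

    opposite-edge : ∀ {i j} → Edge (P l) i j → Edge (P l) (Fin.opposite i) (Fin.opposite j)
    opposite-edge {i} {j} e with proj₂ (to (P-edge l {i} {j}) e)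
    ... | inj₁ eq = Graph.symmetric (P l) (P-consecutive l (opposite-consecutive {i} {j} eq))
    ... | inj₂ eq = P-consecutive l (opposite-consecutive {j} {i} eq)

    opposite-injective : ∀ {i j : Fin l} → Fin.opposite i ≡ Fin.opposite j → i ≡ j
    opposite-injective {i} {j} eq = trans (sym (Fin.opposite-involutive i))
      (trans (cong Fin.opposite eq) (Fin.opposite-involutive j))

  reversed-isomorphism : ∀ {S f} → IsIsomorphism (P l) S f → IsIsomorphism (P l) S (reversed f)
  reversed-isomorphism {S} {f} I = record
    { injective = opposite-injective ∘ injective
    ; into      = λ i → into (Fin.opposite i)
    ; onto      = λ w w∈ → let i , fi≡w = onto w w∈ in
                           Fin.opposite i , trans (cong f (Fin.opposite-involutive i)) fi≡w
    ; edge      = λ i j → mk⇔ (to (edge (Fin.opposite i) (Fin.opposite j)) ∘ opposite-edge {i} {j})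
        (subst₂ (Edge (P l)) (Fin.opposite-involutive i) (Fin.opposite-involutive j)
          ∘ opposite-edge {Fin.opposite i} {Fin.opposite j} ∘ from (edge (Fin.opposite i) (Fin.opposite j)))
    }
    where open IsIsomorphism I

  module _ {S : Subdata n} {f g : Fin l → Fin n}
           (I : IsIsomorphism (P l) S f) (J : IsIsomorphism (P l) S g) where

    private
      module I = IsIsomorphism I
      module J = IsIsomorphism J

      neighbour : ∀ {i j i′} → f i ≡ g i′ → Edge (P l) i j → ∃[ j′ ] g j′ ≡ f j × Edge (P l) i′ j′
      neighbour {i} {j} {i′} fi≡gi′ e with j′ , gj′≡fj ← J.onto (f j) (I.into j) =
        j′ , gj′≡fj , from (J.edge i′ j′)
          (subst₂ (proj₂ S ⟨_⇢_⟩) fi≡gi′ (sym gj′≡fj) (to (I.edge i j) e))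

      -- Strong induction along the path, with `k` bounding the index. The vertex `f (suc i)` is a
      -- neighbour in `S` of the common `i`-th vertex, so it is `g j` with `j` adjacent to `i` in
      -- the path. If `j` were the predecessor of `i`, then `f j` would equal `g j` by induction,
      -- against injectivity of `f`.
      agree-up-to : f zero ≡ g zero → ∀ k i → toℕ i ≤ k → f i ≡ g i
      agree-up-to f0≡g0 k       zero    _   = f0≡g0
      agree-up-to f0≡g0 (suc k) (suc i) i≤k
        with j , gj≡fi , e ← neighbour {Fin.inject₁ i} {suc i}
               (agree-up-to f0≡g0 k (Fin.inject₁ i) (subst (_≤ k) (sym (Fin.toℕ-inject₁ i)) (ℕ.≤-pred i≤k)))
               (P-consecutive l (cong suc (Fin.toℕ-inject₁ i)))
        with proj₂ (to (P-edge l {Fin.inject₁ i} {j}) e)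
      ... | inj₁ eq = trans (sym gj≡fi) (cong g (Fin.toℕ-injective
                        (trans (sym eq) (cong suc (Fin.toℕ-inject₁ i)))))
      ... | inj₂ eq = contradiction (trans (cong (suc ∘ toℕ) (sym j≡)) (trans eq (Fin.toℕ-inject₁ i)))
                        (ℕ.>⇒≢ (ℕ.m≤n⇒m≤1+n ℕ.≤-refl))
        where
        1+j≤k : suc (toℕ j) ≤ k
        1+j≤k = subst (_≤ k) (sym (trans eq (Fin.toℕ-inject₁ i))) (ℕ.≤-pred i≤k)
        j≡ : j ≡ suc i
        j≡ = I.injective (trans (agree-up-to f0≡g0 k j (ℕ.<⇒≤ 1+j≤k)) gj≡fi)

    same-start : f zero ≡ g zero → f ≗ g
    same-start f0≡g0 i = agree-up-to f0≡g0 (toℕ i) i ℕ.≤-refl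

    private
      inner-not-start : ∀ {i} → suc (toℕ i) < suc m → f (suc i) ≢ g zero
      inner-not-start {i} i<m fi≡g0 = ℕ.<⇒≢ (ℕ.m≤n⇒m≤1+n ℕ.≤-refl)
        (trans (sym (Fin.toℕ-inject₁ i)) (trans (cong toℕ before≡after) (Fin.toℕ-fromℕ< (s≤s i<m))))
        where
        after-zero : ∀ {j : Fin l} → Edge (P l) zero j → toℕ j ≡ 1
        after-zero {j} e with proj₂ (to (P-edge l {zero} {j}) e)
        ... | inj₁ eq = sym eq
        before = neighbour {suc i} {Fin.inject₁ i} {zero} fi≡g0
          (Graph.symmetric (P l) (P-consecutive l (cong suc (Fin.toℕ-inject₁ i))))
        after = neighbour {suc i} {fromℕ< (s≤s i<m)} {zero} fi≡g0
          (P-consecutive l (sym (Fin.toℕ-fromℕ< (s≤s i<m))))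
        before≡after : Fin.inject₁ i ≡ fromℕ< (s≤s i<m)
        before≡after = I.injective (trans (sym (proj₁ (proj₂ before))) (trans
          (cong g (Fin.toℕ-injective (trans (after-zero (proj₂ (proj₂ before)))
                                            (sym (after-zero (proj₂ (proj₂ after)))))))
          (proj₁ (proj₂ after))))

    -- An inner vertex of the path has two neighbours, an end has only one.
    start-is-end : g zero ≡ f zero ⊎ g zero ≡ f last
    start-is-end with I.onto (g zero) (J.into zero)
    ... | zero  , f0≡g0 = inj₁ (sym f0≡g0)
    ... | suc i , fi≡g0 with suc (toℕ i) ℕ.<? suc m
    ...   | yes i<m = contradiction fi≡g0 (inner-not-start i<m)
    ...   | no  i≮m = inj₂ (trans (sym fi≡g0) (cong f (Fin.toℕ-injective (trans
              (ℕ.≤-antisym (ℕ.≤-pred (Fin.toℕ<n (suc i))) (ℕ.≮⇒≥ i≮m))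
              (sym (Fin.toℕ-fromℕ (suc m)))))))

  -- The tag makes this relation one-to-one: a vector determines its copy and its tag
  -- (`traversal-determines`), and a tagged copy determines its vector (`traversal-unique`). The
  -- first serves the upper bound, where vectors are counted as walks, the second the lower bound,
  -- where they are counted as paths.
  Traversal : Bool × Subdata n → Vec (Fin n) l → Set
  Traversal (b , S) y = b ≡ ascending (lookup y) × IsSubgraph G S × IsIsomorphism (P l) S (lookup y)

  traversal-determines : ∀ {x x′ y} → Traversal x y → Traversal x′ y → x ≡ x′
  traversal-determines (b≡ , S⊆G , I) (b′≡ , S′⊆G , I′) =
    cong₂ _,_ (trans b≡ (sym b′≡)) (isomorphism-determines {G = G} S⊆G S′⊆G I I′)

  traversal-unique : ∀ {x y y′} → Traversal x y → Traversal x y′ → y ≡ y′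
  traversal-unique {y = y} {y′} (b≡ , _ , I) (b≡′ , _ , J) = begin
    y                     ≡⟨ tabulate∘lookup y ⟨
    tabulate (lookup y)   ≡⟨ tabulate-cong agree ⟩
    tabulate (lookup y′)  ≡⟨ tabulate∘lookup y′ ⟩
    y′                    ∎
    where
    open ≡-Reasoning
    f = lookup y
    g = lookup y′
    agree : f ≗ g
    agree with start-is-end I J
    ... | inj₁ g0≡f0 = same-start I J (sym g0≡f0)
    -- Here `g` would be the reversal of `f`, with the opposite value of `ascending`, although both
    -- values equal the same tag.
    ... | inj₂ g0≡fl = contradiction
      (trans (sym (ascending-reversed f (λ f0≡fl → contradiction (IsIsomorphism.injective I f0≡fl) λ ())))
        (trans (ascending-cong (same-start (reversed-isomorphism I) J (sym g0≡fl))) (trans (sym b≡′) b≡)))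
      (not-≢ (ascending f))
      where
      not-≢ : ∀ b → not b ≢ b
      not-≢ true  ()
      not-≢ false ()

  traversal-exists : ∀ b {S} → IsCopy (P l) G S → ∃ (Traversal (b , S))
  traversal-exists b {S} (S⊆G , f , I) = choose (b Bool.≟ ascending f)
    where
    traverse : ∀ g → IsIsomorphism (P l) S g → b ≡ ascending g → ∃ (Traversal (b , S))
    traverse g J b≡ = tabulate g , trans b≡ (ascending-cong (sym ∘ lookup∘tabulate g)) , S⊆G ,
      isIsomorphism-resp (sym ∘ lookup∘tabulate g) J
    choose : Dec (b ≡ ascending f) → ∃ (Traversal (b , S))
    choose (yes b≡) = traverse f I b≡
    choose (no  b≢) = traverse (reversed f) (reversed-isomorphism I) (trans (Bool.¬-not b≢)
      (sym (ascending-reversed f λ f0≡fl → contradiction (IsIsomorphism.injective I f0≡fl) λ ())))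

  2*copies≤count-walk : 2 * copies (P (suc (suc m))) G ≤ count {m = suc (suc m)} (isWalk? G)
  2*copies≤count-walk = 2*filter≤filter {R = Traversal} (isCopy? (P (suc (suc m))) G) (isWalk? G) {subdata n}
    {vectors (allFin n) (suc (suc m))} (subdata-unique n) (vectors-complete List.∈-allFin) traverse
    (λ {x} {x′} {y} → traversal-determines {x} {x′} {y})
    where
    traverse : ∀ {b S} → IsCopy (P (suc (suc m))) G S → ∃[ y ] Linked.Linked (Edge G) y × Traversal (b , S) y
    traverse {b} {S} copy with y , t@(_ , S⊆G , I) ← traversal-exists b {S} copy
      = y , subst (Linked.Linked (Edge G)) (tabulate∘lookup y) (linked-tabulate λ {i} {j} eq →
          IsSubgraph.edge S⊆G _ _ (to (IsIsomorphism.edge I i j) (P-consecutive l eq))) , t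

  count-path≤2*copies : count {m = suc (suc m)} (isPath? G) ≤ 2 * copies (P (suc (suc m))) G
  count-path≤2*copies = filter≤2*filter {R = Traversal} (isCopy? (P (suc (suc m))) G) (isPath? G) {subdata n}
    {vectors (allFin n) (suc (suc m))} (vectors-unique (List.allFin⁺ n) (suc (suc m))) subdata-complete trace
    (λ {x} {y} {y′} → traversal-unique {x} {y} {y′})
    where
    trace : ∀ {y} → IsPath (Edge G) y → ∃[ b ] ∃[ S ] IsCopy (P (suc (suc m))) G S × Traversal (b , S) y
    trace {y} path with S , S⊆G , I ← path-image G path
      = ascending (lookup y) , S , (S⊆G , lookup y , I) , refl , S⊆G , I

-- Copies of a path in a graph without a given cycle

module _ {n : ℕ} (G : Graph n) where

  open Graph G using (symmetric; irreflexive)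

  adjacency₀₁ : Fin n → Fin n → ℕ
  adjacency₀₁ u v = 𝟙 (edge? G u v)

  adjacency₀₁≤1 : ∀ u v → adjacency₀₁ u v ≤ 1
  adjacency₀₁≤1 u v = 𝟙≤1 (edge? G u v)

  adjacency₀₁-sym : ∀ u v → adjacency₀₁ u v ≡ adjacency₀₁ v u
  adjacency₀₁-sym u v = 𝟙-cong (mk⇔ (symmetric {u} {v}) (symmetric {v} {u})) (edge? G u v) (edge? G v u)

  open WeightedWalks adjacency₀₁ adjacency₀₁≤1 adjacency₀₁-sym

  count-walksFrom : ∀ m u → count {m = m} (λ y → Linked.linked? (edge? G) (u ∷ y)) ≤ walksFrom m u
  count-walksFrom zero    u = s≤s z≤n
  count-walksFrom (suc m) u = ℕ.≤-trans (ℕ.≤-reflexive (count-suc walk?)) (∑-mono first-step)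
    where
    walk? : (y : Vec (Fin n) (suc m)) → Dec (Linked.Linked (Edge G) (u ∷ y))
    walk? y = Linked.linked? (edge? G) (u ∷ y)
    first-step : ∀ v → count (λ y → walk? (v ∷ y)) ≤ adjacency₀₁ u v * walksFrom m v
    first-step v with edge? G u v
    ... | yes e = ℕ.≤-trans (ℕ.≤-reflexive (cong length (List.filter-≐ _ _
            (Linked.tail , λ w → e ∷ w) (vectors (allFin n) m))))
          (ℕ.≤-trans (count-walksFrom m v) (ℕ.≤-reflexive (sym (ℕ.*-identityˡ _))))
    ... | no ¬e = ℕ.≤-reflexive (cong length (List.filter-none _
            (ListAll.universal (λ _ w → ¬e (Linked.head w)) (vectors (allFin n) m))))

  count-walks : ∀ m → count {m = suc (suc m)} (isWalk? G) ≤ walks (suc m)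
  count-walks m = ℕ.≤-trans (ℕ.≤-reflexive (count-suc (isWalk? G))) (∑-mono (count-walksFrom (suc m)))

  -- The graph induced on the neighbourhood of `v`, kept on the vertex set `Fin n` with all other
  -- vertices isolated, so that `Pruning` applies as it stands.
  EdgeAround : Fin n → Rel (Fin n) 0ℓ
  EdgeAround v x z = Edge G v x × Edge G v z × Edge G x z

  edgeAround? : ∀ v → Decidable (EdgeAround v)
  edgeAround? v x z = edge? G v x ×-dec edge? G v z ×-dec edge? G x z

  edgeAround-sym : ∀ v → Symmetric (EdgeAround v)
  edgeAround-sym v (vx , vz , xz) = vz , vx , symmetric xz

  trianglesAt≡ : ∀ v → trianglesAt v ≡ ∑[ x < n ] ∑[ z < n ] 𝟙 (edgeAround? v x z)
  trianglesAt≡ v = ∑∑-cong λ x z → begin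
    adjacency₀₁ v x * adjacency₀₁ v z * adjacency₀₁ x z
      ≡⟨ ℕ.*-assoc (adjacency₀₁ v x) (adjacency₀₁ v z) (adjacency₀₁ x z) ⟩
    adjacency₀₁ v x * (adjacency₀₁ v z * adjacency₀₁ x z)
      ≡⟨ cong (λ t → adjacency₀₁ v x * t) (𝟙-× (edge? G v z) (edge? G x z)) ⟨
    adjacency₀₁ v x * 𝟙 (edge? G v z ×-dec edge? G x z)
      ≡⟨ 𝟙-× (edge? G v x) (edge? G v z ×-dec edge? G x z) ⟨
    𝟙 (edgeAround? v x z)                                    ∎
    where open ≡-Reasoning

  -- Adjacency to `v` is recorded only in the edges of the path, hence the demand for at least two
  -- vertices.
  all-adjacent : ∀ {v m} {ys : Vec (Fin n) (suc (suc m))} → Linked.Linked (EdgeAround v) ys → All (Edge G v) ys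
  all-adjacent {ys = _ ∷ _ ∷ []}    ((vx , vy , _) ∷ _)  = vx ∷ vy ∷ []
  all-adjacent {ys = _ ∷ _ ∷ _ ∷ _} ((vx , _ , _) ∷ ws) = vx ∷ all-adjacent ws

  -- Put `v` in front: irreflexivity makes it a new vertex, and its adjacency to both ends of the
  -- path supplies the two missing edges of the cycle.
  close-path : ∀ {v m} {ys : Vec (Fin n) (suc (suc m))} → IsPath (EdgeAround v) ys →
               ∃ (IsCopy (C (suc (suc (suc m)))) G)
  close-path {v} {m} {ys@(_ ∷ _)} (linked , unique) = cycle-image G
    (All.head v~ys ∷ Linked.map (proj₂ ∘ proj₂) linked , All.map (λ { e refl → irreflexive e }) v~ys ∷ unique)
    (symmetric (All.lookup⁺ v~ys (Fin.fromℕ (suc m))))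
    where
    v~ys : All (Edge G v) ys
    v~ys = all-adjacent linked

  trianglesAt≤ : ∀ q → (C (suc (suc (suc q))) Free) G → ∀ v → trianglesAt v ≤ suc q * (suc q + suc q) * n
  trianglesAt≤ q free v = ℕ.≤-trans (ℕ.≤-reflexive (trianglesAt≡ v))
    -- The forbidden path has one vertex fewer than the cycle, namely `suc (suc q)`, so the pruning
    -- threshold is `suc q`.
    (Pruning.sparse (edgeAround? v) (edgeAround-sym v) (suc q) λ (_ , path) → free (close-path path))

  2*copies≤walks : ∀ m → 2 * copies (P (suc (suc m))) G ≤ walks (suc m)
  2*copies≤walks m = ℕ.≤-trans (2*copies≤count-walk {m = m} G) (count-walks m)

  copies-upper : ∀ q m → (C (suc (suc (suc q))) Free) G → .{{NonZero n}} →
    2 ℕ.^ suc (suc m) * copies (P (suc (suc m))) G ≤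
    n ℕ.^ suc (suc m) + errorConstant (suc q * (suc q + suc q)) (suc m) * n ℕ.^ suc m
  copies-upper q m free = absorb-2 (2 ℕ.^ m) (2*copies≤walks m)
    (walks≤ (suc q * (suc q + suc q)) (trianglesAt≤ q free) (suc m))
    where
    absorb-2 : ∀ t {x w b} → 2 * x ≤ w → 2 * t * w ≤ b → 2 * (2 * t) * x ≤ b
    absorb-2 t {x} {w} {b} 2x≤w 2tw≤b = begin
      2 * (2 * t) * x    ≡⟨ eq t x ⟩
      2 * t * (2 * x)    ≤⟨ ℕ.*-monoʳ-≤ (2 * t) 2x≤w ⟩
      2 * t * w          ≤⟨ 2tw≤b ⟩
      b                  ∎
      where
      open ℕ.≤-Reasoning
      eq : ∀ t c → 2 * (2 * t) * c ≡ 2 * t * (2 * c)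
      eq = solve-∀

-- Many paths in the balanced complete bipartite graph

module _ {n : ℕ} (G : Graph n) {c d : ℕ} (degree≥ : ∀ x → c + d ≤ ∑[ v < n ] 𝟙 (edge? G x v)) where

  open ℕ.≤-Reasoning

  -- The part `d` of the degree is a reserve: extending a path on `suc m` vertices rules out at most
  -- `suc m ≤ d` neighbours of its front vertex, leaving at least `c` choices.
  count-paths : ∀ m → m ≤ d → n * c ℕ.^ m ≤ count {m = suc m} (isPath? G)
  count-paths zero    _   = ℕ.≤-reflexive (sym (trans (count-suc (isPath? G)) (∑-const n 1)))
  count-paths (suc m) m<d = begin
    n * (c * c ℕ.^ m)                      ≡⟨ eq n c (c ℕ.^ m) ⟩
    n * c ℕ.^ m * c                        ≤⟨ ℕ.*-monoˡ-≤ c (count-paths m (ℕ.<⇒≤ m<d)) ⟩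
    count {m = suc m} (isPath? G) * c      ≤⟨ count-extend (isPath? G) (isPath? G) extensions ⟩
    count {m = suc (suc m)} (isPath? G)    ∎
    where
    eq : ∀ n c x → n * (c * x) ≡ n * x * c
    eq = solve-∀
    extensions : (y : Vec (Fin n) (suc m)) → IsPath (Edge G) y → c ≤ ∑[ v < n ] 𝟙 (isPath? G (v ∷ y))
    extensions y@(x ∷ _) (linked , unique) = ℕ.+-cancelʳ-≤ (suc m) _ _ (begin
      c + suc m                                                   ≤⟨ ℕ.+-monoʳ-≤ c m<d ⟩
      c + d                                                       ≤⟨ degree≥ x ⟩
      ∑[ v < n ] 𝟙 (edge? G x v)                                  ≤⟨ fresh-count (edge? G x) y ⟩
      ∑[ v < n ] 𝟙 (edge? G x v ×-dec fresh? y v) + suc m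
        ≡⟨ cong (λ t → t + suc m) (∑-cong λ v → 𝟙-cong (prepend v) (edge? G x v ×-dec fresh? y v) (isPath? G (v ∷ y))) ⟩
      ∑[ v < n ] 𝟙 (isPath? G (v ∷ y)) + suc m                    ∎)
      where
      prepend : ∀ v → (Edge G x v × Fresh y v) ⇔ IsPath (Edge G) (v ∷ y)
      prepend v = mk⇔
        (λ (e , fresh) → Graph.symmetric G e ∷ linked , fresh ∷ unique)
        (λ (ws , us) → Graph.symmetric G (Linked.head ws) , AllPairs.head us)

-- The parity of the index, `true` for even. Colouring by parity balances the two classes and
-- permits induction in steps of two.
side : ∀ {n} → Fin n → Bool
side zero    = true
side (suc i) = not (side i)

opposite-side? : ∀ {n} (u v : Fin n) → Dec (side u ≢ side v)
opposite-side? u v = ¬? (side u Bool.≟ side v)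

bipartite : ∀ n → Graph n
bipartite n = fromRel (opposite-side? {n})

bipartite-edge : ∀ n {u v} → Edge (bipartite n) u v ⇔ (side u ≢ side v)
bipartite-edge n {u} {v} = mk⇔
  (λ e → undirect (proj₂ (to (fromRel-edge (opposite-side? {n})) e)))
  (λ u≁v → from (fromRel-edge (opposite-side? {n})) ((λ { refl → u≁v refl }) , inj₁ u≁v))
  where
  undirect : side u ≢ side v ⊎ side v ≢ side u → side u ≢ side v
  undirect (inj₁ u≁v) = u≁v
  undirect (inj₂ v≁u) = v≁u ∘ sym

-- Two consecutive indices have different parities, so exactly one of them lies opposite to `b`.
side-count : ∀ n b → ℕ.⌊ n /2⌋ ≤ ∑[ v < n ] 𝟙 (¬? (b Bool.≟ side v))
side-count zero          b = z≤n
side-count (suc zero)    b = z≤n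
side-count (suc (suc n)) b = begin
  1 + ℕ.⌊ n /2⌋                                     ≤⟨ s≤s (side-count n b) ⟩
  1 + ∑[ v < n ] 𝟙 (¬? (b Bool.≟ side v))
    ≡⟨ cong₂ ℕ._+_ (sym (one b)) (∑-cong λ v → cong (λ s → 𝟙 (¬? (b Bool.≟ s))) (sym (Bool.not-involutive (side v)))) ⟩
  (p true + p false) + ∑[ v < n ] 𝟙 (¬? (b Bool.≟ side (suc (suc v))))
                                                    ≡⟨ ℕ.+-assoc (p true) (p false) _ ⟩
  p true + (p false + ∑[ v < n ] 𝟙 (¬? (b Bool.≟ side (suc (suc v)))))
                                                    ≡⟨ cong (λ t → p true + t) (∑-suc _) ⟨
  p true + ∑[ v < suc n ] 𝟙 (¬? (b Bool.≟ side (suc v)))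
                                                    ≡⟨ ∑-suc _ ⟨
  ∑[ v < suc (suc n) ] 𝟙 (¬? (b Bool.≟ side v))     ∎
  where
  open ℕ.≤-Reasoning
  p : Bool → ℕ
  p s = 𝟙 (¬? (b Bool.≟ s))
  one : ∀ b → 𝟙 (¬? (b Bool.≟ true)) + 𝟙 (¬? (b Bool.≟ false)) ≡ 1
  one true  = refl
  one false = refl

bipartite-degree : ∀ n u → ℕ.⌊ n /2⌋ ≤ ∑[ v < n ] 𝟙 (edge? (bipartite n) u v)
bipartite-degree n u = ℕ.≤-trans (side-count n (side u)) (ℕ.≤-reflexive (∑-cong λ v →
  𝟙-cong (mk⇔ (from (bipartite-edge n)) (to (bipartite-edge n))) (opposite-side? u v) (edge? (bipartite n) u v)))

alternate : ℕ → Bool → Bool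
alternate zero    b = b
alternate (suc k) b = not (alternate k b)

alternate-even : ∀ k b → alternate (k + k) b ≡ b
alternate-even zero    b = refl
alternate-even (suc k) b = begin
  not (alternate (k + suc k) b)    ≡⟨ cong (λ t → not (alternate t b)) (ℕ.+-suc k k) ⟩
  not (not (alternate (k + k) b))  ≡⟨ Bool.not-involutive _ ⟩
  alternate (k + k) b              ≡⟨ alternate-even k b ⟩
  b                                ∎
  where open ≡-Reasoning

-- Sides alternate along the cycle. The last index `N` is even, so the last vertex is on the side of
-- the first, yet the closing edge joins the two.
bipartite-no-odd-cycle : ∀ n k → (C (suc (suc (suc (k + k)))) Free) (bipartite n)
bipartite-no-odd-cycle n k (S , S⊆G , f , I) = differ {Fin.fromℕ N} {zero} closing (begin
  side (f (Fin.fromℕ N))                        ≡⟨ alternates (Fin.fromℕ N) ⟩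
  alternate (toℕ (Fin.fromℕ N)) (side (f zero))
    ≡⟨ cong (λ t → alternate t (side (f zero))) (Fin.toℕ-fromℕ N) ⟩
  alternate N (side (f zero))
    ≡⟨ trans (Bool.not-involutive _) (alternate-even k _) ⟩
  side (f zero)                                 ∎)
  where
  open ≡-Reasoning
  N = suc (suc (k + k))
  differ : ∀ {i j} → Edge (C (suc N)) i j → side (f i) ≢ side (f j)
  differ {i} {j} e = to (bipartite-edge n) (IsSubgraph.edge S⊆G _ _ (to (IsIsomorphism.edge I i j) e))
  closing : Edge (C (suc N)) (Fin.fromℕ N) zero
  closing = from (C-edge (suc N) {Fin.fromℕ N} {zero}) ((λ ()) , inj₁ (trans (cong (λ t → suc t % suc N) (Fin.toℕ-fromℕ N)) (n%n≡0 (suc N))))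
  step : ∀ i → Edge (C (suc N)) (Fin.inject₁ i) (suc i)
  step i = from (C-edge (suc N) {Fin.inject₁ i} {suc i})
    ( (λ eq → ℕ.1+n≢n (trans (sym (cong toℕ eq)) (Fin.toℕ-inject₁ i)))
    , inj₁ (trans (cong (λ t → suc t % suc N) (Fin.toℕ-inject₁ i)) (m<n⇒m%n≡m (s≤s (Fin.toℕ<n i)))))
  alternates : ∀ i → side (f i) ≡ alternate (toℕ i) (side (f zero))
  alternates = <-weakInduction (λ i → side (f i) ≡ alternate (toℕ i) (side (f zero))) refl λ i ih → begin
    side (f (suc i))
      ≡⟨ Bool.¬-not (differ {Fin.inject₁ i} {suc i} (step i) ∘ sym) ⟩
    not (side (f (Fin.inject₁ i)))                        ≡⟨ cong not ih ⟩
    not (alternate (toℕ (Fin.inject₁ i)) (side (f zero)))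
      ≡⟨ cong (λ t → not (alternate t (side (f zero)))) (Fin.toℕ-inject₁ i) ⟩
    not (alternate (toℕ i) (side (f zero)))               ∎

^-distribʳ-* : ∀ o m n → (m * n) ℕ.^ o ≡ m ℕ.^ o * n ℕ.^ o
^-distribʳ-* zero    m n = refl
^-distribʳ-* (suc o) m n = trans (cong (λ t → m * n * t) (^-distribʳ-* o m n)) (eq m n (m ℕ.^ o) (n ℕ.^ o))
  where
  eq : ∀ m n x y → m * n * (x * y) ≡ m * x * (n * y)
  eq = solve-∀

-- Bernoulli's inequality `(n - e) ^ m ≥ n ^ m - m e n ^ (m - 1)`, multiplied by `n` so that neither
-- subtraction nor the exponent `m - 1` occurs.
bernoulli : ∀ {n r e} → n ≤ r + e → r ≤ n → ∀ m → n ℕ.^ suc m ≤ n * r ℕ.^ m + m * e * n ℕ.^ m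
bernoulli {n} {r} {e} n≤r+e r≤n zero    = ℕ.m≤m+n (n * 1) 0
bernoulli {n} {r} {e} n≤r+e r≤n (suc m) = begin
  n * n ℕ.^ suc m                                  ≤⟨ ℕ.*-monoʳ-≤ n (bernoulli n≤r+e r≤n m) ⟩
  n * (n * r ℕ.^ m + m * e * n ℕ.^ m)              ≡⟨ eq₁ n (r ℕ.^ m) m e (n ℕ.^ m) ⟩
  n * (n * r ℕ.^ m) + m * e * (n * n ℕ.^ m)
    ≤⟨ ℕ.+-monoˡ-≤ _ (ℕ.*-monoˡ-≤ (n * r ℕ.^ m) n≤r+e) ⟩
  (r + e) * (n * r ℕ.^ m) + m * e * (n * n ℕ.^ m)  ≡⟨ eq₂ n r (r ℕ.^ m) m e (n ℕ.^ m) ⟩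
  n * (r * r ℕ.^ m) + m * e * (n * n ℕ.^ m) + e * n * r ℕ.^ m
    ≤⟨ ℕ.+-monoʳ-≤ (n * (r * r ℕ.^ m) + m * e * (n * n ℕ.^ m)) (ℕ.*-monoʳ-≤ (e * n) (ℕ.^-monoˡ-≤ m r≤n)) ⟩
  n * (r * r ℕ.^ m) + m * e * (n * n ℕ.^ m) + e * n * n ℕ.^ m
                                                   ≡⟨ eq₃ n (r * r ℕ.^ m) m e (n ℕ.^ m) ⟩
  n * (r * r ℕ.^ m) + suc m * e * (n * n ℕ.^ m)    ∎
  where
  open ℕ.≤-Reasoning
  eq₁ : ∀ n x m e y → n * (n * x + m * e * y) ≡ n * (n * x) + m * e * (n * y)
  eq₁ = solve-∀
  eq₂ : ∀ n r x m e y → (r + e) * (n * x) + m * e * (n * y) ≡ n * (r * x) + m * e * (n * y) + e * n * x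
  eq₂ = solve-∀
  eq₃ : ∀ n x m e y → n * x + m * e * (n * y) + e * n * y ≡ n * x + suc m * e * (n * y)
  eq₃ = solve-∀

n≤2*⌊n/2⌋+1 : ∀ n → n ≤ 2 * ℕ.⌊ n /2⌋ + 1
n≤2*⌊n/2⌋+1 zero          = z≤n
n≤2*⌊n/2⌋+1 (suc zero)    = s≤s z≤n
n≤2*⌊n/2⌋+1 (suc (suc n)) = ℕ.≤-trans (s≤s (s≤s (n≤2*⌊n/2⌋+1 n))) (ℕ.≤-reflexive (eq ℕ.⌊ n /2⌋))
  where
  eq : ∀ h → 2 + (2 * h + 1) ≡ 2 * (1 + h) + 1
  eq = solve-∀

2*⌊n/2⌋≤n : ∀ n → 2 * ℕ.⌊ n /2⌋ ≤ n
2*⌊n/2⌋≤n zero          = z≤n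
2*⌊n/2⌋≤n (suc zero)    = z≤n
2*⌊n/2⌋≤n (suc (suc n)) = ℕ.≤-trans (ℕ.≤-reflexive (eq ℕ.⌊ n /2⌋)) (s≤s (s≤s (2*⌊n/2⌋≤n n)))
  where
  eq : ∀ h → 2 * (1 + h) ≡ 2 + 2 * h
  eq = solve-∀

regroup-powers : ∀ {n} d {c x K} → n * c ℕ.^ d ≤ 2 * x → n ℕ.^ suc d ≤ n * (2 * c) ℕ.^ d + K → n ℕ.^ suc d ≤ 2 ℕ.^ suc d * x + K
regroup-powers {n} d {c} {x} {K} ncᵈ≤2x nᵈ≤ = begin
  n ℕ.^ suc d                        ≤⟨ nᵈ≤ ⟩
  n * (2 * c) ℕ.^ d + K              ≡⟨ cong (λ t → n * t + K) (^-distribʳ-* d 2 c) ⟩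
  n * (2 ℕ.^ d * c ℕ.^ d) + K        ≡⟨ eq₁ n (2 ℕ.^ d) (c ℕ.^ d) K ⟩
  2 ℕ.^ d * (n * c ℕ.^ d) + K        ≤⟨ ℕ.+-monoˡ-≤ K (ℕ.*-monoʳ-≤ (2 ℕ.^ d) ncᵈ≤2x) ⟩
  2 ℕ.^ d * (2 * x) + K              ≡⟨ eq₂ (2 ℕ.^ d) x K ⟩
  2 ℕ.^ suc d * x + K                ∎
  where
  open ℕ.≤-Reasoning
  eq₁ : ∀ n a b K → n * (a * b) + K ≡ a * (n * b) + K
  eq₁ = solve-∀
  eq₂ : ∀ a x K → a * (2 * x) + K ≡ 2 * a * x + K
  eq₂ = solve-∀

-- Every vertex has at least `h` neighbours. Of these, `d`, the number of edges of the path, are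
-- held in reserve, leaving `c` choices per step. Then `2 * c` falls short of `n` by at most
-- `2 * d + 1`, the 1 allowing for odd `n`, and `bernoulli` over `d` steps yields the constant
-- `d * (2 * d + 1)`. The condition on `n` ensures `d ≤ h`.
copies-lower : ∀ n m → 2 * suc m ≤ n →
  n ℕ.^ suc (suc m) ≤
  2 ℕ.^ suc (suc m) * copies (P (suc (suc m))) (bipartite n) + suc m * (2 * suc m + 1) * n ℕ.^ suc m
copies-lower n m 2d≤n = main (ℕ.m≤n⇒∃[o]m+o≡n d≤h)
  where
  open ℕ.≤-Reasoning
  d = suc m
  h = ℕ.⌊ n /2⌋
  d≤h : d ≤ h
  d≤h = begin
    d                  ≡⟨ ℕ.n≡⌊n+n/2⌋ d ⟩
    ℕ.⌊ d + d /2⌋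
      ≤⟨ ℕ.⌊n/2⌋-mono (ℕ.≤-trans (ℕ.≤-reflexive (cong (λ t → d + t) (sym (ℕ.+-identityʳ d)))) 2d≤n) ⟩
    h                  ∎
  main : ∃[ c ] d + c ≡ h →
         n ℕ.^ suc (suc m) ≤ 2 ℕ.^ suc (suc m) * copies (P (suc (suc m))) (bipartite n) + suc m * (2 * suc m + 1) * n ℕ.^ suc m
  main (c , d+c≡h) = regroup-powers {n} (suc m) {c}
    (ℕ.≤-trans (count-paths (bipartite n) degree≥ (suc m) ℕ.≤-refl) (count-path≤2*copies {m = m} (bipartite n)))
    (bernoulli n≤2c+e 2c≤n (suc m))
    where
    degree≥ : ∀ u → c + d ≤ ∑[ v < n ] 𝟙 (edge? (bipartite n) u v)
    degree≥ u = ℕ.≤-trans (ℕ.≤-reflexive (trans (ℕ.+-comm c d) d+c≡h)) (bipartite-degree n u)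
    n≤2c+e : n ≤ 2 * c + (2 * d + 1)
    n≤2c+e = begin
      n                        ≤⟨ n≤2*⌊n/2⌋+1 n ⟩
      2 * h + 1                ≡⟨ cong (λ t → 2 * t + 1) d+c≡h ⟨
      2 * (d + c) + 1          ≡⟨ eq d c ⟩
      2 * c + (2 * d + 1)      ∎
      where
      eq : ∀ d c → 2 * (d + c) + 1 ≡ 2 * c + (2 * d + 1)
      eq = solve-∀
    2c≤n : 2 * c ≤ n
    2c≤n = begin
      2 * c                    ≤⟨ ℕ.*-monoʳ-≤ 2 (ℕ.m≤n+m c d) ⟩
      2 * (d + c)              ≡⟨ cong (λ t → 2 * t) d+c≡h ⟩
      2 * h                    ≤⟨ 2*⌊n/2⌋≤n n ⟩
      n                        ∎

-- Two-sided bounds on the extremal number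

ex-upper-bound : ∀ k m n .{{_ : NonZero n}} →
  2 ℕ.^ suc (suc m) * ex n (P (suc (suc m))) (C (suc (suc (suc (k + k))))) ≤
  n ℕ.^ suc (suc m) + errorConstant (suc (k + k) * (suc (k + k) + suc (k + k))) (suc m) * n ℕ.^ suc m
-- The bipartite graph witnesses that some graph is free of the cycle, so that `ex` is attained by a
-- free graph and is not merely the default value 0.
ex-upper-bound k m n = bound
  (ex-attained (P (suc (suc m))) (C (suc (suc (suc (k + k))))) {bipartite n} (bipartite-no-odd-cycle n k))
  where
  K = errorConstant (suc (k + k) * (suc (k + k) + suc (k + k))) (suc m)
  bound : ∃[ G ] (C (suc (suc (suc (k + k)))) Free) G ×
                 copies (P (suc (suc m))) G ≡ ex n (P (suc (suc m))) (C (suc (suc (suc (k + k))))) →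
          2 ℕ.^ suc (suc m) * ex n (P (suc (suc m))) (C (suc (suc (suc (k + k))))) ≤
          n ℕ.^ suc (suc m) + K * n ℕ.^ suc m
  bound (G , free , attained) =
    subst (λ t → 2 ℕ.^ suc (suc m) * t ≤ n ℕ.^ suc (suc m) + K * n ℕ.^ suc m) attained (copies-upper G (k + k) m free)

ex-lower-bound : ∀ k m n → 2 * suc m ≤ n →
  n ℕ.^ suc (suc m) ≤
  2 ℕ.^ suc (suc m) * ex n (P (suc (suc m))) (C (suc (suc (suc (k + k))))) + suc m * (2 * suc m + 1) * n ℕ.^ suc m
ex-lower-bound k m n large = ℕ.≤-trans (copies-lower n m large)
  (ℕ.+-monoˡ-≤ (suc m * (2 * suc m + 1) * n ℕ.^ suc m) (ℕ.*-monoʳ-≤ (2 ℕ.^ suc (suc m))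
    (ex-upper (P (suc (suc m))) (C (suc (suc (suc (k + k))))) {bipartite n} (bipartite-no-odd-cycle n k))))

-- From bounds on natural numbers to the asymptotic statement

-- `_/_` cancels common factors, so identities between fractions with variable entries are checked
-- on their unnormalised forms.
toℚᵘ-/ : ∀ i d .{{_ : NonZero d}} → ℚ.toℚᵘ (i / d) ℚᵘ.≃ i ℚᵘ./ d
toℚᵘ-/ i (suc d) = ℚ.toℚᵘ-fromℚᵘ (ℚᵘ.mkℚᵘ i d)

/-cross : ∀ {a b} d e .{{_ : NonZero d}} .{{_ : NonZero e}} → a * e ≡ b * d → + a / d ≡ + b / e
/-cross {a} {b} (suc d) (suc e) ae≡bd = ℚ.fromℚᵘ-cong {ℚᵘ.mkℚᵘ (+ a) d} {ℚᵘ.mkℚᵘ (+ b) e}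
  (ℚᵘ.*≡* (trans (sym (ℤ.pos-* a (suc e))) (trans (cong (λ t → + t) ae≡bd) (ℤ.pos-* b (suc d)))))

/-* : ∀ a b d e .{{_ : NonZero d}} .{{_ : NonZero e}} .{{_ : NonZero (d * e)}} →
      (+ a / d) ℚ.* (+ b / e) ≡ + (a * b) / (d * e)
/-* a b d@(suc _) e@(suc _) = ℚ.toℚᵘ-injective (begin
  ℚ.toℚᵘ ((+ a / d) ℚ.* (+ b / e))              ≈⟨ ℚ.toℚᵘ-homo-* (+ a / d) (+ b / e) ⟩
  ℚ.toℚᵘ (+ a / d) ℚᵘ.* ℚ.toℚᵘ (+ b / e)        ≈⟨ ℚᵘ.*-cong (toℚᵘ-/ (+ a) d) (toℚᵘ-/ (+ b) e) ⟩
  (+ a ℤ.* + b) ℚᵘ./ (d * e)                    ≡⟨ cong (λ t → t ℚᵘ./ (d * e)) (sym (ℤ.pos-* a b)) ⟩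
  + (a * b) ℚᵘ./ (d * e)                        ≈⟨ toℚᵘ-/ (+ (a * b)) (d * e) ⟨
  ℚ.toℚᵘ (+ (a * b) / (d * e))                  ∎)
  where open import Relation.Binary.Reasoning.Setoid ℚᵘ.≃-setoid

1+/ : ∀ i d .{{_ : NonZero d}} → ℚ.1ℚ ℚ.+ i / d ≡ (+ d ℤ.+ i) / d
1+/ i d@(suc d′) = ℚ.toℚᵘ-injective (begin
  ℚ.toℚᵘ (ℚ.1ℚ ℚ.+ i / d)                        ≈⟨ ℚ.toℚᵘ-homo-+ ℚ.1ℚ (i / d) ⟩
  ℚᵘ.1ℚᵘ ℚᵘ.+ ℚ.toℚᵘ (i / d)                     ≈⟨ ℚᵘ.+-cong (ℚᵘ.≃-refl {ℚᵘ.1ℚᵘ}) (toℚᵘ-/ i d) ⟩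
  ℚᵘ.1ℚᵘ ℚᵘ.+ i ℚᵘ./ d
    ≡⟨ cong₂ ℚᵘ.mkℚᵘ (cong₂ ℤ._+_ (ℤ.*-identityˡ (+ d)) (ℤ.*-identityʳ i)) (ℕ.+-identityʳ d′) ⟩
  (+ d ℤ.+ i) ℚᵘ./ d                             ≈⟨ toℚᵘ-/ (+ d ℤ.+ i) d ⟨
  ℚ.toℚᵘ ((+ d ℤ.+ i) / d)                       ∎)
  where open import Relation.Binary.Reasoning.Setoid ℚᵘ.≃-setoid

/-^ : ∀ a d m .{{_ : NonZero d}} .{{_ : NonZero (d ℕ.^ m)}} → (+ a / d) ^ m ≡ + (a ℕ.^ m) / (d ℕ.^ m)
/-^ a d zero    = refl
/-^ a d (suc m) = trans (cong (λ t → (+ a / d) ℚ.* t) (/-^ a d m)) (/-* a (a ℕ.^ m) d (d ℕ.^ m))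
  where
  instance
    dᵐ≢0 : NonZero (d ℕ.^ m)
    dᵐ≢0 = ℕ.m^n≢0 d m

-- Used with `D = n ^ l` and `T = 2 ^ l`: the exact relative error is taken as the `o(1)` term, so
-- the required equation is an identity and only smallness remains to be shown.
relative-error : ∀ a D T .{{_ : NonZero D}} .{{_ : NonZero T}} →
                 (1ℚ ℚ.+ (+ (T * a) ℤ.- + D) / D) ℚ.* (+ D / T) ≡ fromℕ a
relative-error a D T = begin
  (1ℚ ℚ.+ e / D) ℚ.* (+ D / T)       ≡⟨ cong (λ t → t ℚ.* (+ D / T)) (1+/ e D) ⟩
  (+ D ℤ.+ e) / D ℚ.* (+ D / T)
    ≡⟨ cong (λ i → i / D ℚ.* (+ D / T)) (cancel (+ D) (+ (T * a))) ⟩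
  (+ (T * a) / D) ℚ.* (+ D / T)      ≡⟨ /-* (T * a) D D T ⟩
  + (T * a * D) / (D * T)            ≡⟨ /-cross {T * a * D} {a} (D * T) 1 (eq T a D) ⟩
  fromℕ a                            ∎
  where
  open ≡-Reasoning
  e = + (T * a) ℤ.- + D
  instance
    DT≢0 : NonZero (D * T)
    DT≢0 = ℕ.m*n≢0 D T
  cancel : ∀ d x → d ℤ.+ (x ℤ.- d) ≡ x
  cancel d x = trans (ℤ.+-comm d (x ℤ.- d)) (trans (ℤ.+-assoc x (ℤ.- d) d)
    (trans (cong (λ t → x ℤ.+ t) (ℤ.+-inverseˡ d)) (ℤ.+-identityʳ x)))
  eq : ∀ T a D → T * a * D * 1 ≡ a * (D * T)
  eq = solve-∀

-- A positive `ε` has numerator at least 1, so it suffices to compare with the reciprocal of its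
-- denominator.
∣/∣<ε : ∀ i d .{{_ : NonZero d}} {ε} → 0ℚ ℚ.< ε → ℤ.∣ i ∣ * ℚ.↧ₙ ε < d → ℚ.∣ i / d ∣ ℚ.< ε
∣/∣<ε i d@(suc _) {ε@(ℚ.mkℚ (ℤ.+[1+ p ]) q _)} _ small = ℚ.toℚᵘ-cancel-< (ℚᵘ.<-respˡ-≃
  (ℚᵘ.≃-sym (ℚᵘ.≃-trans (ℚ.toℚᵘ-homo-∣-∣ (i / d)) (ℚᵘ.∣-∣-cong (toℚᵘ-/ i d))))
  (ℚᵘ.*<* (subst₂ ℤ._<_ (ℤ.pos-* ℤ.∣ i ∣ (suc q)) (ℤ.pos-* (suc p) d)
    (ℤ.+<+ (ℕ.<-≤-trans small (ℕ.m≤n*m d (suc p)))))))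
∣/∣<ε i d {ℚ.mkℚ (+ 0) _ _}      (ℚ.*<* (ℤ.+<+ ()))
∣/∣<ε i d {ℚ.mkℚ ℤ.-[1+ _ ] _ _} (ℚ.*<* ())

∣-∣≤ : ∀ {x y e} → x ≤ y + e → y ≤ x + e → ℤ.∣ + x ℤ.- + y ∣ ≤ e
∣-∣≤ {x} {y} {e} x≤y+e y≤x+e = ℕ.≤-trans (ℕ.≤-reflexive (cong ℤ.∣_∣ (ℤ.m-n≡m⊖n x y))) (bound (ℕ.≤-total x y))
  where
  bound : x ≤ y ⊎ y ≤ x → ℤ.∣ x ℤ.⊖ y ∣ ≤ e
  bound (inj₁ x≤y) = ℕ.≤-trans (ℕ.≤-reflexive (ℤ.∣⊖∣-≤ x≤y)) (ℕ.m≤n+o⇒m∸n≤o y x y≤x+e)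
  bound (inj₂ y≤x) = ℕ.≤-trans (ℕ.≤-reflexive (trans (ℤ.∣m⊖n∣≡∣n⊖m∣ x y) (ℤ.∣⊖∣-≤ y≤x))) (ℕ.m≤n+o⇒m∸n≤o x y x≤y+e)

module _ (a : ℕ → ℕ) (M N K : ℕ)
         (upper : ∀ n .{{_ : NonZero n}} → N ≤ n → 2 ℕ.^ suc M * a n ≤ n ℕ.^ suc M + K * n ℕ.^ M)
         (lower : ∀ n .{{_ : NonZero n}} → N ≤ n → n ℕ.^ suc M ≤ 2 ℕ.^ suc M * a n + K * n ℕ.^ M) where

  private
    error : ℕ → ℤ.ℤ
    error n = + (2 ℕ.^ suc M * a n) ℤ.- + (n ℕ.^ suc M)

    δ : ℕ → ℚ.ℚ
    -- A placeholder where `n ^ suc M` vanishes; `exact` is claimed from `n = 1` on.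
    δ zero        = 0ℚ
    δ n@(suc _) = (error n / n ℕ.^ suc M) {{ℕ.m^n≢0 n (suc M)}}

  asymptotic : (λ n → fromℕ (a n)) ≡[1+o[1]] (λ n → (+ n / 2) ^ suc M)
  asymptotic = δ , small , 1 , exact
    where
    small : o[1] δ
    -- The error is at most `K * n ^ M`. Multiplied by the denominator of `ε` it stays below
    -- `n ^ suc M` as soon as `n` exceeds `K` times that denominator.
    small ε ε>0 = suc (N + K * ℚ.↧ₙ ε) , bound
      where
      open ℕ.≤-Reasoning
      N≤ : ∀ {n} → suc (N + K * ℚ.↧ₙ ε) ≤ n → N ≤ n
      N≤ large = ℕ.≤-trans (ℕ.m≤m+n N _) (ℕ.<⇒≤ large)
      eq : ∀ K x q → K * x * q ≡ K * q * x
      eq = solve-∀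
      bound : ∀ n → suc (N + K * ℚ.↧ₙ ε) ≤ n → ℚ.∣ δ n ∣ ℚ.< ε
      bound n@(suc _) large = ∣/∣<ε (error n) (n ℕ.^ suc M) {{ℕ.m^n≢0 n (suc M)}} ε>0 (begin-strict
        ℤ.∣ error n ∣ * ℚ.↧ₙ ε
          ≤⟨ ℕ.*-monoˡ-≤ (ℚ.↧ₙ ε) (∣-∣≤ (upper n (N≤ large)) (lower n (N≤ large))) ⟩
        K * n ℕ.^ M * ℚ.↧ₙ ε        ≡⟨ eq K (n ℕ.^ M) (ℚ.↧ₙ ε) ⟩
        K * ℚ.↧ₙ ε * n ℕ.^ M
          <⟨ ℕ.*-monoˡ-< (n ℕ.^ M) {{ℕ.m^n≢0 n M}} (ℕ.≤-trans (s≤s (ℕ.m≤n+m (K * ℚ.↧ₙ ε) N)) large) ⟩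
        n ℕ.^ suc M                 ∎)
    exact : ∀ n → 1 ≤ n → fromℕ (a n) ≡ (1ℚ ℚ.+ δ n) ℚ.* (+ n / 2) ^ suc M
    exact n@(suc _) _ = sym (trans
      (cong (λ t → (1ℚ ℚ.+ δ n) ℚ.* t) (/-^ n 2 (suc M) {{_}} {{T≢0}}))
      (relative-error (a n) (n ℕ.^ suc M) (2 ℕ.^ suc M) {{ℕ.m^n≢0 n (suc M)}} {{T≢0}}))
      where
      T≢0 : NonZero (2 ℕ.^ suc M)
      T≢0 = ℕ.m^n≢0 2 (suc M)

theorem19 : ∀ (k l : ℕ) → 1 ≤ k → 2 ≤ l →
    (λ n → fromℕ (ex n (P l) (C (suc (2 * k))))) ≡[1+o[1]] (λ n → (+ n / 2) ^ l)
theorem19 (suc k) (suc (suc m)) (s≤s z≤n) (s≤s (s≤s z≤n)) =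
  -- `2 * suc k` does not reduce to `suc (suc (k + k))`, the form that exposes both a length of at
  -- least 3 and the parity needed for `alternate-even`.
  subst (λ N → (λ n → fromℕ (ex n (P (suc (suc m))) (C (suc N)))) ≡[1+o[1]] (λ n → (+ n / 2) ^ suc (suc m)))
    (eq k) (asymptotic exₙ (suc m) (2 * suc m) (K₁ + K₂) upper lower)
  where
  exₙ : ℕ → ℕ
  exₙ n = ex n (P (suc (suc m))) (C (suc (suc (suc (k + k)))))
  K₁ = errorConstant (suc (k + k) * (suc (k + k) + suc (k + k))) (suc m)
  K₂ = suc m * (2 * suc m + 1)
  eq : ∀ k → suc (suc (k + k)) ≡ 2 * suc k
  eq = solve-∀
  widen : ∀ {x y K K′} z → K ≤ K′ → x ≤ y + K * z → x ≤ y + K′ * z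
  widen {y = y} z K≤K′ x≤ = ℕ.≤-trans x≤ (ℕ.+-monoʳ-≤ y (ℕ.*-monoˡ-≤ z K≤K′))
  upper : ∀ n .{{_ : NonZero n}} → 2 * suc m ≤ n →
          2 ℕ.^ suc (suc m) * exₙ n ≤ n ℕ.^ suc (suc m) + (K₁ + K₂) * n ℕ.^ suc m
  upper n _ = widen {y = n ℕ.^ suc (suc m)} (n ℕ.^ suc m) (ℕ.m≤m+n K₁ K₂) (ex-upper-bound k m n)
  lower : ∀ n .{{_ : NonZero n}} → 2 * suc m ≤ n →
          n ℕ.^ suc (suc m) ≤ 2 ℕ.^ suc (suc m) * exₙ n + (K₁ + K₂) * n ℕ.^ suc m
  lower n large = widen {y = 2 ℕ.^ suc (suc m) * exₙ n} (n ℕ.^ suc m) (ℕ.m≤n+m K₂ K₁) (ex-lower-bound k m n large)
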